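{- Let $H$ be a forest and let $k\ge 1$ be an integer. Then every $\{H,K_{k+1}\}$-free graph $G$ satisfies $\alpha(G)\ge |G|^{1-o(1)}$, and hence has chromatic number at most $O(|G|^{o(1)})$. That is, for every $\varepsilon>0$ there exists $n_0$ (depending only on $H,k,\varepsilon$) such that every $\{H,K_{k+1}\}$-free graph $G$ with $|G|\ge n_0$ satisfies $\alpha(G)\ge |G|^{1-\varepsilon}$; and for every $\varepsilon>0$ there exists $C$ (depending only on $H,k,\varepsilon$) such that every $\{H,K_{k+1}\}$-free graph $G$ with at least one vertex satisfies $\chi(G)\le C|G|^{\varepsilon}$.
   Context: Graphs are finite, with no loops or parallel edges. $|G|$ is the number of vertices of $G$, $\chi(G)$ its chromatic number, and $\alpha(G)$ the size of its largest stable (i.e. independent) set. A graph $G$ is $H$-free if no induced subgraph of $G$ is isomorphic to $H$; for a set $\mathcal{H}$ of graphs, $G$ is $\mathcal{H}$-free if it is $H$-free for each $H\in\mathcal{H}$. The $o(1)$ terms are as $|G|\to\infty$ with $H$ and $k$ fixed. -}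

module Defs where

open import Data.Nat using (ℕ; zero; suc; _+_; _*_; _^_; _≤_; z≤n; s≤s)
open import Data.Nat.Properties using (≤-pred; ≤∧≢⇒<)
import Data.Nat.Properties as ℕ
open import Data.Integer using (ℤ; +_; -[1+_]; -_)
open import Data.Rational.Unnormalised using (ℚᵘ; ↥_; ↧ₙ_)
open import Data.Fin using (Fin; zero; suc; inject₁; fromℕ; finToFun; funToFin)
import Data.Fin.Properties as Fin
open import Data.Fin.Subset using (Subset; _∈_; ∣_∣; ⊥)
open import Data.Fin.Subset.Properties using (anySubset?; ∣p∣≤n; ∣⊥∣≡0; ∉⊥; _∈?_)
open import Data.Product using (∃; _×_; _,_; proj₁)
open import Function using (_∘_; id; _⇔_; Injective)
open import Level using (0ℓ)
open import Relation.Binary using (Rel; Decidable; Symmetric; Irreflexive)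
open import Relation.Binary.PropositionalEquality
  using (_≡_; _≢_; refl; subst; subst₂; ≢-sym)
open import Relation.Nullary using (¬_; yes; no; ¬?; contradiction)
open import Relation.Nullary.Decidable using (map′; _×-dec_; _→-dec_)
open import Relation.Unary using (Pred) renaming (Decidable to Decidable₁)

-- A finite simple graph, with vertex set {0, …, order - 1}.
record Graph : Set₁ where
  field
    order  : ℕ
    Adj    : Rel (Fin order) 0ℓ
    adj?   : Decidable Adj
    symm   : Symmetric Adj
    irrefl : Irreflexive _≡_ Adj

  Vertex : Set
  Vertex = Fin order

open Graph public using (order; Vertex; Adj)

complete : ℕ → Graph
complete n = record
  { order  = n
  ; Adj    = _≢_
  ; adj?   = λ u v → ¬? (u Fin.≟ v)
  ; symm   = ≢-sym
  ; irrefl = λ u≡v u≢v → u≢v u≡v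
  }

-- An isomorphism from H onto an induced subgraph of G, namely the one induced
-- on the image of the embedding.
record InducedCopy (H G : Graph) : Set where
  field
    embed     : Vertex H → Vertex G
    injective : Injective _≡_ _≡_ embed
    adjacency : ∀ u v → Adj H u v ⇔ Adj G (embed u) (embed v)

_IsFreeOf_ : Graph → Graph → Set
G IsFreeOf H = ¬ InducedCopy H G

-- A (not necessarily induced) cycle with 3 + l distinct vertices.
record Cycle (G : Graph) : Set where
  field
    l        : ℕ
    vertex   : Fin (3 + l) → Vertex G
    distinct : Injective _≡_ _≡_ vertex
    step     : ∀ (i : Fin (2 + l)) → Adj G (vertex (inject₁ i)) (vertex (suc i))
    close    : Adj G (vertex (fromℕ (2 + l))) (vertex zero)

IsForest : Graph → Set
IsForest G = ¬ Cycle G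

Stable : (G : Graph) → Subset (order G) → Set
Stable G S = ∀ u v → u ∈ S → v ∈ S → ¬ Adj G u v

HasStableSet : Graph → ℕ → Set
HasStableSet G m = ∃ λ S → Stable G S × ∣ S ∣ ≡ m

Proper : (G : Graph) (k : ℕ) → (Vertex G → Fin k) → Set
Proper G k c = ∀ u v → Adj G u v → c u ≢ c v

Colourable : Graph → ℕ → Set
Colourable G k = ∃ λ c → Proper G k c

IsGreatest : Pred ℕ 0ℓ → ℕ → Set
IsGreatest P m = P m × (∀ k → P k → k ≤ m)

IsLeast : Pred ℕ 0ℓ → ℕ → Set
IsLeast P m = P m × (∀ k → P k → m ≤ k)

greatest : ∀ {P : Pred ℕ 0ℓ} → Decidable₁ P → P 0 →
           ∀ b → (∀ k → P k → k ≤ b) → ∃ (IsGreatest P)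
greatest     P? p0 zero    bound = 0 , p0 , bound
greatest {P} P? p0 (suc b) bound with P? (suc b)
... | yes p = suc b , p , bound
... | no ¬p = greatest P? p0 b λ k pk →
  ≤-pred (≤∧≢⇒< (bound k pk) λ k≡ → ¬p (subst P k≡ pk))

least : ∀ {P : Pred ℕ 0ℓ} → Decidable₁ P → ∀ b → P b → ∃ (IsLeast P)
least P? zero    pb = 0 , pb , λ _ _ → z≤n
least P? (suc b) pb with P? 0
... | yes p0 = 0 , p0 , λ _ _ → z≤n
... | no ¬p0 with least (P? ∘ suc) b pb
...   | m , pm , min = suc m , pm , λ where
          zero    p → contradiction p ¬p0
          (suc k) p → s≤s (min k p)

stable? : (G : Graph) → Decidable₁ (Stable G)
stable? G S = Fin.all? λ u → Fin.all? λ v →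
  (u ∈? S) →-dec ((v ∈? S) →-dec ¬? (Graph.adj? G u v))

hasStableSet? : (G : Graph) → Decidable₁ (HasStableSet G)
hasStableSet? G m = anySubset? λ S → stable? G S ×-dec (∣ S ∣ ℕ.≟ m)

proper? : (G : Graph) (k : ℕ) → Decidable₁ (Proper G k)
proper? G k c = Fin.all? λ u → Fin.all? λ v →
  Graph.adj? G u v →-dec ¬? (c u Fin.≟ c v)

colourable? : (G : Graph) → Decidable₁ (Colourable G)
colourable? G k = map′
  (λ (i , p) → finToFun i , p)
  (λ (c , p) → funToFin c , λ u v uv eq →
    p u v uv (subst₂ _≡_ (Fin.finToFun-funToFin c u) (Fin.finToFun-funToFin c v) eq))
  (Fin.any? (λ i → proper? G k (finToFun i)))

maxStableSet : (G : Graph) → ∃ (IsGreatest (HasStableSet G))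
maxStableSet G = greatest (hasStableSet? G)
  (⊥ , (λ _ _ u∈⊥ → contradiction u∈⊥ ∉⊥) , ∣⊥∣≡0 (order G))
  (order G)
  λ { _ (S , _ , refl) → ∣p∣≤n S }

minColouring : (G : Graph) → ∃ (IsLeast (Colourable G))
minColouring G = least (colourable? G) (order G)
  (id , λ _ _ uv u≡v → Graph.irrefl G u≡v uv)

α : Graph → ℕ
α G = proj₁ (maxStableSet G)

χ : Graph → ℕ
χ G = proj₁ (minColouring G)

posPart negPart : ℤ → ℕ
posPart (+ n)    = n
posPart -[1+ _ ] = 0
negPart z = posPart (- z)

-- Comparisons with a real power nʳ, for rational r = a / q with q ≥ 1: both
-- sides are raised to the q-th power and multiplied by n^(a⁻), where
-- a = a⁺ - a⁻. For n ≥ 1 this is an equivalence.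

-- nʳ ≤ y
Power≤ : (n : ℕ) (r : ℚᵘ) (y : ℕ) → Set
Power≤ n r y = n ^ posPart (↥ r) ≤ y ^ (↧ₙ r) * n ^ negPart (↥ r)

-- x ≤ C nʳ
≤Power : (x C n : ℕ) (r : ℚᵘ) → Set
≤Power x C n r = x ^ (↧ₙ r) * n ^ negPart (↥ r) ≤ C ^ (↧ₙ r) * n ^ posPart (↥ r)

{-# OPTIONS --safe #-}
module Submission where

-- By induction on k, and then on d, every {H, K_{k+1}}-free graph G with maximum
-- degree at most d has α(G) ≥ c |G| / d^(1/q), for every q. Suppose G is a
-- counterexample with d large. A set of vertices inducing maximum degree d′ < d
-- then has size less than |G| (d′/d)^(1/q); so degrees of order d persist in all
-- large sets. By induction on k, any set inside a neighbourhood loses only a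
-- factor B = d^o(1) when a stable set is extracted from it.
--
-- Say U is obstructed if it contains a stable I of size about d and a set Z of
-- size O(Bd) such that the vertices of I have few neighbours in U ∖ Z. If all large
-- U were obstructed, removing I ∪ Z repeatedly would leave a large union of such
-- sets I, which induces a sparse graph, contradicting the minimality of d. In an
-- unobstructed U the forest H is embedded one leaf at a time: each embedded vertex
-- keeps a large set of neighbours in U from which its children are to be chosen,
-- and these sets stay pairwise sparse to each other because each new one avoids
-- the O(d) vertices having many neighbours in an older one.

open import Defs
open import Algebra.Properties.CommutativeSemigroup using (interchange)
open import Data.Bool using (true)
open import Data.Empty using (⊥; ⊥-elim)
open import Data.Fin using (Fin; zero; suc; toℕ; fromℕ<)
import Data.Fin.Properties as Fin
open import Data.Fin.Subset using (Subset; ∣_∣) renaming (_∈_ to _∈ˢ_)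
open import Data.Fin.Subset.Properties using (anySubset?) renaming (_∈?_ to _∈ˢ?_)
open import Data.Integer using (-[1+_]; _⊖_; +<+) renaming (+_ to pos; -_ to neg)
import Data.Integer.Properties as ℤ
open import Data.Nat using (ℕ; zero; suc; _+_; _*_; _^_; _∸_; _/_; _≤_; z≤n; s≤s; NonZero)
import Data.Nat as ℕ
open import Data.Nat.DivMod using (m/n*n≤m; m*n/n≡m; /-monoˡ-≤)
open import Data.Nat.Properties
open import Data.Nat.Tactic.RingSolver using (solve-∀)
open import Data.Product using (Σ; _×_; _,_; proj₁; proj₂; ∃-syntax)
open import Data.Rational.Unnormalised using (ℚᵘ; mkℚᵘ; *<*; 0ℚᵘ; 1ℚᵘ; _<_; _-_)
open import Data.Sum using (_⊎_; inj₁; inj₂; [_,_]′)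
open import Data.Unit using (tt)
open import Data.Vec using (tabulate)
open import Data.Vec.Properties using ([]=⇒lookup; lookup⇒[]=; lookup∘tabulate)
open import Function using (_∘_; mk⇔)
open import Relation.Binary.PropositionalEquality
  using (_≡_; _≢_; refl; sym; trans; cong; cong₂; subst; module ≡-Reasoning)
open import Relation.Nullary using (Dec; yes; no; does; ¬_; ¬?; contradiction)
open import Relation.Nullary.Decidable using (_×-dec_; _⊎-dec_; _→-dec_; dec-true; decidable-stable; map′)
open import Relation.Unary using (Decidable)

private variable
  m n : ℕ

-- Decidable sets of vertices and sums over them

record FinSet (n : ℕ) : Set₁ where
  field
    Member  : Fin n → Set
    member? : Decidable Member

open FinSet

infix 4 _∈_ _⊆_
infixr 7 _∩_
infixl 6 _∖_

_∈_ : Fin n → FinSet n → Set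
x ∈ P = Member P x

_⊆_ : FinSet n → FinSet n → Set
P ⊆ Q = ∀ x → x ∈ P → x ∈ Q

⟅_⟆ : {P : Fin n → Set} → Decidable P → FinSet n
⟅ P? ⟆ = record { member? = P? }

_∩_ _∖_ _∪_ : FinSet n → FinSet n → FinSet n
P ∩ Q = ⟅ (λ x → member? P x ×-dec member? Q x) ⟆
P ∖ Q = ⟅ (λ x → member? P x ×-dec ¬? (member? Q x)) ⟆
P ∪ Q = ⟅ (λ x → member? P x ⊎-dec member? Q x) ⟆

full : FinSet n
full = ⟅ (λ _ → yes tt) ⟆

⋃ : (Fin m → FinSet n) → FinSet n
⋃ Z = ⟅ (λ x → Fin.any? λ i → member? (Z i) x) ⟆

tail : FinSet (suc n) → FinSet n
tail P = ⟅ (λ x → member? P (suc x)) ⟆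

-- The decision is an explicit argument, so that facts about sums reduce to matching on decisions
-- rather than on sets.
when : {A : Set} → Dec A → ℕ → ℕ
when (yes _) k = k
when (no _)  _ = 0

∑ : FinSet n → (Fin n → ℕ) → ℕ
∑ {zero}  P f = 0
∑ {suc n} P f = when (member? P zero) (f zero) + ∑ (tail P) (f ∘ suc)

card : FinSet n → ℕ
card P = ∑ P λ _ → 1

when-mono : {A B : Set} (a? : Dec A) (b? : Dec B) {k l : ℕ} →
            (A → B × k ≤ l) → when a? k ≤ when b? l
when-mono (yes a) (yes _) le = proj₂ (le a)
when-mono (yes a) (no ¬b) le = contradiction (proj₁ (le a)) ¬b
when-mono (no _)  _       le = z≤n

∑-mono : (P Q : FinSet n) {f g : Fin n → ℕ} →
         (∀ x → x ∈ P → x ∈ Q × f x ≤ g x) → ∑ P f ≤ ∑ Q g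
∑-mono {zero}  P Q le = z≤n
∑-mono {suc n} P Q le = +-mono-≤
  (when-mono (member? P zero) (member? Q zero) (le zero))
  (∑-mono (tail P) (tail Q) (le ∘ suc))

card-mono : (P Q : FinSet n) → P ⊆ Q → card P ≤ card Q
card-mono P Q P⊆Q = ∑-mono P Q λ x x∈P → P⊆Q x x∈P , ≤-refl

∑-cong : (P : FinSet n) {f g : Fin n → ℕ} →
         (∀ x → x ∈ P → f x ≡ g x) → ∑ P f ≡ ∑ P g
∑-cong P eq = ≤-antisym
  (∑-mono P P λ x x∈P → x∈P , ≤-reflexive (eq x x∈P))
  (∑-mono P P λ x x∈P → x∈P , ≤-reflexive (sym (eq x x∈P)))

when-* : {A : Set} (a? : Dec A) (k l : ℕ) → k * when a? l ≡ when a? (k * l)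
when-* (yes _) k l = refl
when-* (no _)  k l = *-zeroʳ k

*-∑ : (P : FinSet n) (k : ℕ) (f : Fin n → ℕ) → k * ∑ P f ≡ ∑ P λ x → k * f x
*-∑ {zero}  P k f = *-zeroʳ k
*-∑ {suc n} P k f = trans (*-distribˡ-+ k (when (member? P zero) (f zero)) _)
  (cong₂ _+_ (when-* (member? P zero) k (f zero)) (*-∑ (tail P) k (f ∘ suc)))

∑-const : (P : FinSet n) (k : ℕ) → ∑ P (λ _ → k) ≡ k * card P
∑-const P k = trans (∑-cong P λ _ _ → sym (*-identityʳ k)) (sym (*-∑ P k λ _ → 1))

∑-zero : (P : FinSet n) → ∑ P (λ _ → 0) ≡ 0
∑-zero P = ∑-const P 0

when-+ : {A : Set} (a? : Dec A) (k l : ℕ) → when a? (k + l) ≡ when a? k + when a? l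
when-+ (yes _) k l = refl
when-+ (no _)  k l = refl

+-interchange : ∀ a b c d → (a + b) + (c + d) ≡ (a + c) + (b + d)
+-interchange = interchange +-commutativeSemigroup

∑-+ : (P : FinSet n) (f g : Fin n → ℕ) → ∑ P (λ x → f x + g x) ≡ ∑ P f + ∑ P g
∑-+ {zero}  P f g = refl
∑-+ {suc n} P f g = trans
  (cong₂ _+_ (when-+ (member? P zero) (f zero) (g zero)) (∑-+ (tail P) (f ∘ suc) (g ∘ suc)))
  (+-interchange (when (member? P zero) (f zero)) _ _ _)

when-∑ : {A : Set} (a? : Dec A) (P : FinSet n) (f : Fin n → ℕ) →
         when a? (∑ P f) ≡ ∑ P λ x → when a? (f x)
when-∑ (yes _) P f = refl
when-∑ (no _)  P f = sym (∑-zero P)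

∑-comm : (P : FinSet m) (Q : FinSet n) (f : Fin m → Fin n → ℕ) →
         (∑ P λ x → ∑ Q λ y → f x y) ≡ (∑ Q λ y → ∑ P λ x → f x y)
∑-comm {zero}  P Q f = sym (∑-zero Q)
∑-comm {suc m} P Q f = trans
  (cong₂ _+_ (when-∑ (member? P zero) Q (f zero)) (∑-comm (tail P) Q (f ∘ suc)))
  (sym (∑-+ Q _ _))

when-cover : {A B C : Set} (a? : Dec A) (b? : Dec B) (c? : Dec C) (k : ℕ) →
             (A → B ⊎ C) → when a? k ≤ when b? k + when c? k
when-cover (no _)  _       _       k cover = z≤n
when-cover (yes _) (yes _) _       k cover = m≤m+n k _
when-cover (yes _) (no _)  (yes _) k cover = ≤-refl
when-cover (yes a) (no ¬b) (no ¬c) k cover = ⊥-elim ([ ¬b , ¬c ]′ (cover a))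

∑-cover : (P Q R : FinSet n) (f : Fin n → ℕ) →
          (∀ x → x ∈ P → x ∈ Q ⊎ x ∈ R) → ∑ P f ≤ ∑ Q f + ∑ R f
∑-cover {zero}  P Q R f cover = z≤n
∑-cover {suc n} P Q R f cover = ≤-trans
  (+-mono-≤ (when-cover (member? P zero) (member? Q zero) (member? R zero) _ (cover zero))
            (∑-cover (tail P) (tail Q) (tail R) (f ∘ suc) (cover ∘ suc)))
  (≤-reflexive (+-interchange (when (member? Q zero) (f zero)) _ _ _))

when-disjoint : {A B C : Set} (a? : Dec A) (b? : Dec B) (c? : Dec C) (k : ℕ) →
                (A → C) → (B → C) → (A → ¬ B) → when a? k + when b? k ≤ when c? k
when-disjoint (yes a) (yes b) _       k ac bc a#b = contradiction b (a#b a)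
when-disjoint (yes a) (no _)  (no ¬c) k ac bc a#b = contradiction (ac a) ¬c
when-disjoint (yes a) (no _)  (yes _) k ac bc a#b = ≤-reflexive (+-identityʳ k)
when-disjoint (no _)  (yes b) (no ¬c) k ac bc a#b = contradiction (bc b) ¬c
when-disjoint (no _)  (yes _) (yes _) k ac bc a#b = ≤-refl
when-disjoint (no _)  (no _)  _       k ac bc a#b = z≤n

∑-disjoint : (P Q R : FinSet n) (f : Fin n → ℕ) → P ⊆ R → Q ⊆ R →
             (∀ x → x ∈ P → ¬ x ∈ Q) → ∑ P f + ∑ Q f ≤ ∑ R f
∑-disjoint {zero}  P Q R f P⊆R Q⊆R P#Q = z≤n
∑-disjoint {suc n} P Q R f P⊆R Q⊆R P#Q = ≤-trans
  (≤-reflexive (+-interchange (when (member? P zero) (f zero)) _ _ _))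
  (+-mono-≤
    (when-disjoint (member? P zero) (member? Q zero) (member? R zero) _
      (P⊆R zero) (Q⊆R zero) (P#Q zero))
    (∑-disjoint (tail P) (tail Q) (tail R) (f ∘ suc) (P⊆R ∘ suc) (Q⊆R ∘ suc) (P#Q ∘ suc)))

card-∖ : (P Q : FinSet n) → card P ≤ card (P ∩ Q) + card (P ∖ Q)
card-∖ P Q = ∑-cover P (P ∩ Q) (P ∖ Q) _ λ x x∈P → split x∈P (member? Q x)
  where
  split : ∀ {x} → x ∈ P → Dec (x ∈ Q) → x ∈ P ∩ Q ⊎ x ∈ P ∖ Q
  split x∈P (yes x∈Q) = inj₁ (x∈P , x∈Q)
  split x∈P (no x∉Q)  = inj₂ (x∈P , x∉Q)

-- The factor `k` clears denominators: each set is bounded by a fraction `b / k`, and no division is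
-- carried out.
card-⋃ : (k : ℕ) (Z : Fin m → FinSet n) {b : ℕ} → (∀ i → k * card (Z i) ≤ b) →
         k * card (⋃ Z) ≤ m * b
card-⋃ {zero}  {n} k Z le = ≤-trans
  (*-monoʳ-≤ k (≤-trans (∑-mono (⋃ Z) full {g = λ _ → 0} λ { x (() , _) })
                        (≤-reflexive (∑-zero {n} full))))
  (≤-reflexive (*-zeroʳ k))
card-⋃ {suc m} k Z le = ≤-trans
  (*-monoʳ-≤ k (∑-cover (⋃ Z) (Z zero) (⋃ (Z ∘ suc)) _ λ where
    x (zero  , x∈Z) → inj₁ x∈Z
    x (suc i , x∈Z) → inj₂ (i , x∈Z)))
  (≤-trans (≤-reflexive (*-distribˡ-+ k (card (Z zero)) _))
           (+-mono-≤ (le zero) (card-⋃ k (Z ∘ suc) (le ∘ suc))))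

card-full : ∀ n → card (full {n}) ≡ n
card-full zero    = refl
card-full (suc n) = cong suc (card-full n)

card≤n : (P : FinSet n) → card P ≤ n
card≤n {n} P = ≤-trans (card-mono P full λ _ _ → tt) (≤-reflexive (card-full n))

nonempty : (P : FinSet n) → 1 ≤ card P → ∃[ x ] x ∈ P
nonempty P 1≤ with Fin.any? (member? P)
... | yes x∈P = x∈P
... | no  ∄x  = contradiction
  (≤-trans 1≤ (≤-trans (∑-mono P P {g = λ _ → 0} λ x x∈P → ⊥-elim (∄x (x , x∈P)))
                       (≤-reflexive (∑-zero P))))
  λ ()

card-positive : (P : FinSet n) {x : Fin n} → x ∈ P → 1 ≤ card P
card-positive {suc n} P {zero}  x∈P with member? P zero
... | yes _  = s≤s z≤n
... | no x∉P = contradiction x∈P x∉P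
card-positive {suc n} P {suc x} x∈P =
  ≤-trans (card-positive (tail P) x∈P) (m≤n+m _ (when (member? P zero) 1))

markov : (P Q : FinSet n) (f : Fin n → ℕ) (k : ℕ) →
         (∀ x → x ∈ P → x ∈ Q × k ≤ f x) → k * card P ≤ ∑ Q f
markov P Q f k le = ≤-trans (≤-reflexive (sym (∑-const P k))) (∑-mono P Q le)

∑-bound : (P : FinSet n) (f : Fin n → ℕ) (k : ℕ) →
          (∀ x → x ∈ P → f x ≤ k) → ∑ P f ≤ k * card P
∑-bound P f k le = ≤-trans (∑-mono P P λ x x∈P → x∈P , le x x∈P) (≤-reflexive (∑-const P k))

when-∩ : {A B : Set} (a? : Dec A) (b? : Dec B) → when (a? ×-dec b?) 1 ≡ when b? (when a? 1)
when-∩ (yes _) (yes _) = refl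
when-∩ (yes _) (no _)  = refl
when-∩ (no _)  (yes _) = refl
when-∩ (no _)  (no _)  = refl

-- Writing an intersection as a sum of indicators turns double counting into an interchange of sums.
card-∩ : (P Q : FinSet n) → card (P ∩ Q) ≡ ∑ Q λ x → when (member? P x) 1
card-∩ {zero}  P Q = refl
card-∩ {suc n} P Q = cong₂ _+_ (when-∩ (member? P zero) (member? Q zero)) (card-∩ (tail P) (tail Q))

-- Neighbourhoods, stable sets and degrees

⁅_⁆ : Fin n → FinSet n
⁅ x ⁆ = ⟅ (x Fin.≟_) ⟆

card-⁅⁆ : (x : Fin n) → card ⁅ x ⁆ ≤ 1
card-⁅⁆ {suc n} zero = s≤s (≤-trans
  (∑-mono (tail ⁅ zero {n} ⁆) full {g = λ _ → 0} λ _ ()) (≤-reflexive (∑-zero (full {n}))))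
card-⁅⁆ {suc n} (suc x) = ≤-trans
  (card-mono (tail ⁅ suc x ⁆) ⁅ x ⁆ λ _ → Fin.suc-injective)
  (card-⁅⁆ x)

∑-incidence : (R : Fin n → FinSet n) → (∀ x y → y ∈ R x → x ∈ R y) → (P Q : FinSet n) →
              ∑ P (λ x → card (R x ∩ Q)) ≡ ∑ Q (λ y → card (R y ∩ P))
∑-incidence R R-sym P Q = begin
  (∑ P λ x → card (R x ∩ Q))                     ≡⟨ ∑-cong P (λ x _ → card-∩ (R x) Q) ⟩
  (∑ P λ x → ∑ Q λ y → when (member? (R x) y) 1) ≡⟨ ∑-comm P Q _ ⟩
  (∑ Q λ y → ∑ P λ x → when (member? (R x) y) 1) ≡⟨ ∑-cong Q (λ y _ → ∑-cong P λ x _ → swap x y) ⟩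
  (∑ Q λ y → ∑ P λ x → when (member? (R y) x) 1) ≡⟨ ∑-cong Q (λ y _ → card-∩ (R y) P) ⟨
  (∑ Q λ y → card (R y ∩ P))                     ∎
  where
  open ≡-Reasoning
  le : ∀ x y → when (member? (R x) y) 1 ≤ when (member? (R y) x) 1
  le x y = when-mono (member? (R x) y) (member? (R y) x) λ r → R-sym x y r , ≤-refl
  swap : ∀ x y → when (member? (R x) y) 1 ≡ when (member? (R y) x) 1
  swap x y = ≤-antisym (le x y) (le y x)

module _ (G : Graph) where

  open Graph G using (adj?; symm; irrefl)

  private
    V : Set₁
    V = FinSet (order G)

  N : Vertex G → V
  N v = ⟅ adj? v ⟆

  N[_] : Vertex G → V
  N[ v ] = ⁅ v ⁆ ∪ N v

  N[]-sym : ∀ x y → y ∈ N[ x ] → x ∈ N[ y ]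
  N[]-sym x y (inj₁ x≡y) = inj₁ (sym x≡y)
  N[]-sym x y (inj₂ xy)  = inj₂ (symm xy)

  IsStable : V → Set
  IsStable I = ∀ x y → x ∈ I → y ∈ I → ¬ Adj G x y

  MaxDegree≤ : V → ℕ → Set
  MaxDegree≤ X d = ∀ v → v ∈ X → card (N v ∩ X) ≤ d

  -- CliqueFree k X says that X contains no clique of size k + 1.
  CliqueFree : ℕ → V → Set
  CliqueFree zero    X = ∀ v → ¬ v ∈ X
  CliqueFree (suc k) X = ∀ v → v ∈ X → CliqueFree k (N v ∩ X)

  cliqueFree-⊆ : ∀ k (X Y : V) → Y ⊆ X → CliqueFree k X → CliqueFree k Y
  cliqueFree-⊆ zero    X Y Y⊆X free v v∈Y = free v (Y⊆X v v∈Y)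
  cliqueFree-⊆ (suc k) X Y Y⊆X free v v∈Y =
    cliqueFree-⊆ k (N v ∩ X) (N v ∩ Y) (λ { x (xv , x∈Y) → xv , Y⊆X x x∈Y }) (free v (Y⊆X v v∈Y))

  maxDegree-⊆ : ∀ (X Y : V) {d} → Y ⊆ X → MaxDegree≤ X d → MaxDegree≤ Y d
  maxDegree-⊆ X Y Y⊆X deg v v∈Y = ≤-trans
    (card-mono (N v ∩ Y) (N v ∩ X) λ { x (vx , x∈Y) → vx , Y⊆X x x∈Y })
    (deg v (Y⊆X v v∈Y))

  card-N[] : ∀ (X : V) {d} → MaxDegree≤ X d → ∀ v → v ∈ X → card (N[ v ] ∩ X) ≤ suc d
  card-N[] X deg v v∈X = ≤-trans
    (∑-cover (N[ v ] ∩ X) ⁅ v ⁆ (N v ∩ X) _ λ where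
      x (inj₁ v≡x , _)  → inj₁ v≡x
      x (inj₂ vx , x∈X) → inj₂ (vx , x∈X))
    (+-mono-≤ (card-⁅⁆ v) (deg v v∈X))

  stable-insert : ∀ (I : V) v → IsStable I → (∀ x → x ∈ I → ¬ x ∈ N[ v ]) →
                  IsStable (⁅ v ⁆ ∪ I)
  stable-insert I v st far x y (inj₁ refl) (inj₁ refl) xy = irrefl refl xy
  stable-insert I v st far x y (inj₁ refl) (inj₂ y∈I)  xy = far y y∈I (inj₂ xy)
  stable-insert I v st far x y (inj₂ x∈I)  (inj₁ refl) xy = far x x∈I (inj₂ (symm xy))
  stable-insert I v st far x y (inj₂ x∈I)  (inj₂ y∈I)  xy = st x y x∈I y∈I xy

  -- Each chosen vertex costs its closed neighbourhood, hence at most `suc d` vertices.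
  greedyStable : ∀ {d} (X : V) → MaxDegree≤ X d →
                 ∃[ I ] (I ⊆ X × IsStable I × card X ≤ suc d * card I)
  greedyStable {d} X = go (card X) X ≤-refl
    where
    go : ∀ b (Y : V) → card Y ≤ b → MaxDegree≤ Y d →
         ∃[ I ] (I ⊆ Y × IsStable I × card Y ≤ suc d * card I)
    go b Y Y≤b deg with Fin.any? (member? Y)
    ... | no ∄y = Y , (λ _ y∈Y → y∈Y) , (λ x _ x∈Y → ⊥-elim (∄y (x , x∈Y)))
                , m≤m+n (card Y) (d * card Y)
    go zero    Y Y≤b deg | yes (v , v∈Y) =
      contradiction (≤-trans (card-positive Y v∈Y) Y≤b) λ ()
    go (suc b) Y Y≤b deg | yes (v , v∈Y)
      with go b (Y ∖ N[ v ]) (≤-pred (≤-trans shrink Y≤b))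
             (maxDegree-⊆ Y (Y ∖ N[ v ]) (λ _ → proj₁) deg)
      where
      shrink : suc (card (Y ∖ N[ v ])) ≤ card Y
      shrink = ≤-trans (+-monoˡ-≤ _ (card-positive ⁅ v ⁆ {v} refl))
        (∑-disjoint ⁅ v ⁆ (Y ∖ N[ v ]) Y _ (λ { _ refl → v∈Y }) (λ _ → proj₁)
          λ { _ refl (_ , v∉) → v∉ (inj₁ refl) })
    ... | I , I⊆ , st , le = ⁅ v ⁆ ∪ I
      , (λ { _ (inj₁ refl) → v∈Y ; x (inj₂ x∈I) → proj₁ (I⊆ x x∈I) })
      , stable-insert I v st (λ x x∈I → proj₂ (I⊆ x x∈I))
      , (begin
          card Y                                       ≤⟨ card-∖ Y N[ v ] ⟩
          card (Y ∩ N[ v ]) + card (Y ∖ N[ v ])        ≤⟨ +-mono-≤ nbrs le ⟩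
          suc d + suc d * card I                       ≡⟨ *-suc (suc d) (card I) ⟨
          suc d * suc (card I)                         ≤⟨ *-monoʳ-≤ (suc d) grow ⟩
          suc d * card (⁅ v ⁆ ∪ I)                     ∎)
      where
      open ≤-Reasoning
      nbrs : card (Y ∩ N[ v ]) ≤ suc d
      nbrs = ≤-trans
        (card-mono (Y ∩ N[ v ]) (N[ v ] ∩ Y) λ { _ (x∈Y , vx) → vx , x∈Y })
        (card-N[] Y deg v v∈Y)
      grow : suc (card I) ≤ card (⁅ v ⁆ ∪ I)
      grow = ≤-trans (+-monoˡ-≤ _ (card-positive ⁅ v ⁆ {v} refl))
        (∑-disjoint ⁅ v ⁆ I (⁅ v ⁆ ∪ I) _ (λ _ → inj₁) (λ _ → inj₂)
          λ { x refl v∈I → proj₂ (I⊆ x v∈I) (inj₁ refl) })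

  degreeSum : V → ℕ
  degreeSum Y = ∑ Y λ y → card (N y ∩ Y)

  lowDegree : V → ℕ → V
  lowDegree Y b = ⟅ (λ y → member? Y y ×-dec (card (N y ∩ Y) ≤? b)) ⟆

  -- Markov's inequality: with average degree at most `2 * b`, at most half of the vertices have
  -- degree above `4 * b`.
  lowDegree-half : ∀ Y b → degreeSum Y ≤ 2 * b * card Y →
                   card Y ≤ 2 * card (lowDegree Y (4 * b))
  lowDegree-half Y b sum≤ = +-cancelˡ-≤ y y (2 * l) (begin
    y + y                     ≡⟨ cong (y +_) (+-identityʳ y) ⟨
    2 * y                     ≤⟨ *-monoʳ-≤ 2 (card-∖ Y L) ⟩
    2 * (card (Y ∩ L) + card (Y ∖ L))
      ≤⟨ *-monoʳ-≤ 2 (+-monoˡ-≤ _ (card-mono (Y ∩ L) L λ _ → proj₂)) ⟩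
    2 * (l + card (Y ∖ L))    ≡⟨ *-distribˡ-+ 2 l _ ⟩
    2 * l + 2 * card (Y ∖ L)  ≤⟨ +-monoʳ-≤ (2 * l) high ⟩
    2 * l + y                 ≡⟨ +-comm (2 * l) y ⟩
    y + 2 * l                 ∎)
    where
    open ≤-Reasoning
    L = lowDegree Y (4 * b)
    y = card Y
    l = card L
    k = card (Y ∖ L)
    high : 2 * k ≤ y
    high = *-cancelˡ-≤ (suc (4 * b)) (begin
      suc (4 * b) * (2 * k)  ≡⟨ lemma₁ (suc (4 * b)) k ⟩
      2 * (suc (4 * b) * k)  ≤⟨ *-monoʳ-≤ 2 (markov (Y ∖ L) Y _ (suc (4 * b))
                                  λ { x (x∈Y , x∉L) → x∈Y , ≰⇒> λ le → x∉L (x∈Y , le) }) ⟩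
      2 * degreeSum Y        ≤⟨ *-monoʳ-≤ 2 sum≤ ⟩
      2 * (2 * b * y)        ≡⟨ lemma₂ b y ⟩
      4 * b * y              ≤⟨ *-monoˡ-≤ y (n≤1+n (4 * b)) ⟩
      suc (4 * b) * y        ∎)
      where
      lemma₁ : ∀ a k → a * (2 * k) ≡ 2 * (a * k)
      lemma₁ = solve-∀
      lemma₂ : ∀ b y → 2 * (2 * b * y) ≡ 4 * b * y
      lemma₂ = solve-∀

  -- As `I` is stable, the only new edges run between `A` and `I`. There are at most `b * card I` of
  -- them and each is counted twice, so the average stays below `2 * b`.
  degreeSum-∪ : ∀ A I b → IsStable I → (∀ x → x ∈ A → ¬ x ∈ I) →
                (∀ s → s ∈ I → card (N s ∩ A) ≤ b) →
                degreeSum A ≤ 2 * b * card A → degreeSum (A ∪ I) ≤ 2 * b * card (A ∪ I)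
  degreeSum-∪ A I b st A#I few sum≤ = begin
    degreeSum (A ∪ I)
      ≤⟨ ∑-cover (A ∪ I) A I _ (λ _ x∈ → x∈) ⟩
    ∑ A (λ y → card (N y ∩ (A ∪ I))) + ∑ I (λ y → card (N y ∩ (A ∪ I)))
      ≤⟨ +-mono-≤ fromA fromI ⟩
    (degreeSum A + cross) + cross
      ≤⟨ +-mono-≤ (+-mono-≤ sum≤ cross≤) cross≤ ⟩
    (2 * b * card A + b * card I) + b * card I
      ≡⟨ regroup b (card A) (card I) ⟩
    2 * b * (card A + card I)
      ≤⟨ *-monoʳ-≤ (2 * b) (∑-disjoint A I (A ∪ I) _ (λ _ → inj₁) (λ _ → inj₂) A#I) ⟩
    2 * b * card (A ∪ I)  ∎
    where
    open ≤-Reasoning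
    cross : ℕ
    cross = ∑ I λ y → card (N y ∩ A)
    cross≤ : cross ≤ b * card I
    cross≤ = ∑-bound I _ b few
    regroup : ∀ b a i → (2 * b * a + b * i) + b * i ≡ 2 * b * (a + i)
    regroup = solve-∀
    fromA : ∑ A (λ y → card (N y ∩ (A ∪ I))) ≤ degreeSum A + cross
    fromA = begin
      ∑ A (λ y → card (N y ∩ (A ∪ I)))
        ≤⟨ ∑-mono A A (λ y y∈A → y∈A , ∑-cover (N y ∩ (A ∪ I)) (N y ∩ A) (N y ∩ I) _ λ where
             x (yx , inj₁ x∈A) → inj₁ (yx , x∈A)
             x (yx , inj₂ x∈I) → inj₂ (yx , x∈I)) ⟩
      ∑ A (λ y → card (N y ∩ A) + card (N y ∩ I))
        ≡⟨ ∑-+ A _ _ ⟩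
      degreeSum A + ∑ A (λ y → card (N y ∩ I))
        ≡⟨ cong (degreeSum A +_) (∑-incidence N (λ _ _ → symm) A I) ⟩
      degreeSum A + cross  ∎
    fromI : ∑ I (λ y → card (N y ∩ (A ∪ I))) ≤ cross
    fromI = ∑-mono I I λ y y∈I → y∈I , card-mono (N y ∩ (A ∪ I)) (N y ∩ A) λ where
      x (yx , inj₁ x∈A) → yx , x∈A
      x (yx , inj₂ x∈I) → contradiction yx (st y x y∈I x∈I)

-- Halving, leaves, empty sets and exponents

half : ∀ a b c → a ≤ b + c → 2 * b ≤ a → a ≤ 2 * c
half a b c a≤b+c 2b≤a = +-cancelˡ-≤ a a (2 * c) (begin
  a + a            ≡⟨ cong (a +_) (+-identityʳ a) ⟨
  2 * a            ≤⟨ *-monoʳ-≤ 2 a≤b+c ⟩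
  2 * (b + c)      ≡⟨ *-distribˡ-+ 2 b c ⟩
  2 * b + 2 * c    ≤⟨ +-monoˡ-≤ (2 * c) 2b≤a ⟩
  a + 2 * c        ∎)
  where open ≤-Reasoning

-- Isolated vertices count as leaves: they are where the embedding starts a new component.
Leaf : (H : Graph) → FinSet (order H) → Vertex H → Set
Leaf H D u = (∀ i → i ∈ D → ¬ Adj H u i) ⊎
             ∃[ p ] (p ∈ D × Adj H u p × (∀ i → i ∈ D → Adj H u i → i ≡ p))

∅ : FinSet n
∅ = ⟅_⟆ {P = λ _ → ⊥} λ _ → no λ ()

∑-∅ : ∀ n (f : Fin n → ℕ) → ∑ ∅ f ≡ 0
∑-∅ n f = trans (∑-cong {n} ∅ {g = λ _ → 0} λ _ ()) (∑-zero {n} ∅)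

∑-increase : (f g : Fin n → ℕ) (i : Fin n) (x : ℕ) → (∀ j → f j ≤ g j) → f i + x ≤ g i →
             ∑ full f + x ≤ ∑ full g
∑-increase {suc n} f g zero x f≤g fx≤g = begin
  (f zero + s) + x  ≡⟨ +-assoc (f zero) s x ⟩
  f zero + (s + x)  ≡⟨ cong (f zero +_) (+-comm s x) ⟩
  f zero + (x + s)  ≡⟨ +-assoc (f zero) x s ⟨
  (f zero + x) + s  ≤⟨ +-mono-≤ fx≤g (∑-mono (tail full) (tail full) λ j _ → tt , f≤g (suc j)) ⟩
  ∑ full g          ∎
  where
  open ≤-Reasoning
  s = ∑ (tail full) (f ∘ suc)
∑-increase {suc n} f g (suc i) x f≤g fx≤g = ≤-trans
  (≤-reflexive (+-assoc (f zero) _ x))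
  (+-mono-≤ (f≤g zero) (∑-increase (f ∘ suc) (g ∘ suc) i x (f≤g ∘ suc) fx≤g))

^-distribʳ-* : ∀ a b q → (a * b) ^ q ≡ a ^ q * b ^ q
^-distribʳ-* a b zero    = refl
^-distribʳ-* a b (suc q) = trans (cong (a * b *_) (^-distribʳ-* a b q)) (lemma a b (a ^ q) (b ^ q))
  where
  lemma : ∀ a b x y → a * b * (x * y) ≡ a * x * (b * y)
  lemma = solve-∀

-- After t steps the reservoirs have size at least d / B^(exponent q t). The next
-- exponent is dictated by (d′/d)^(1/q): to gain on a union of sets of size
-- d / B^(4 + e), their outside degrees must be below d / B^((4 + e) q).
exponent : ℕ → ℕ → ℕ
exponent q zero    = 1
exponent q (suc t) = 2 + (4 + exponent q t) * q

exponent-step : ∀ q t .⦃ _ : NonZero q ⦄ → suc (exponent q t) ≤ exponent q (suc t)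
exponent-step q t = s≤s (≤-trans (m≤n+m (exponent q t) 5) (s≤s (m≤m*n (4 + exponent q t) q)))

exponent-mono : ∀ q .⦃ _ : NonZero q ⦄ {s t} → s ≤ t → exponent q s ≤ exponent q t
exponent-mono q {s} s≤t with m≤n⇒∃[o]m+o≡n s≤t
... | o , refl = go o
  where
  go : ∀ o → exponent q s ≤ exponent q (s + o)
  go zero    = ≤-reflexive (cong (exponent q) (sym (+-identityʳ s)))
  go (suc o) = ≤-trans (go o) (≤-trans (n≤1+n _)
    (≤-trans (exponent-step q (s + o)) (≤-reflexive (cong (exponent q) (sym (+-suc s o))))))

-- The parameter B absorbs every constant; "critical" is the minimality of d and
-- "local" comes from the smaller clique number.
module Critical
  (G H : Graph) (X : FinSet (order G)) (q d B : ℕ)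
  .⦃ _ : NonZero q ⦄ .⦃ _ : NonZero B ⦄
  (deg : MaxDegree≤ G X d)
  (critical : ∀ Y d′ → Y ⊆ X → 1 ≤ d′ → d′ ℕ.< d → MaxDegree≤ G Y d′ →
              card Y ^ q * d ℕ.< card X ^ q * d′)
  (local : ∀ v S → v ∈ X → S ⊆ N G v ∩ X →
           ∃[ I ] (I ⊆ S × IsStable G I × card S ≤ B * card I))
  (16[1+h]≤B : 16 * suc (order H) ≤ B)
  (B^≤d : B ^ suc (exponent q (order H)) ≤ d)
  (1≤n : 1 ≤ card X)
  where

  private
    V : Set₁
    V = FinSet (order G)
    h : ℕ
    h = order H

  e : ℕ → ℕ
  e = exponent q

  infixl 7 _÷B^_

  _÷B^_ : ℕ → ℕ → ℕ
  x ÷B^ k = _/_ x (B ^ k) ⦃ m^n≢0 B k ⦄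

  ÷B^-* : ∀ x k → (x ÷B^ k) * B ^ k ≤ x
  ÷B^-* x k = m/n*n≤m x (B ^ k) ⦃ m^n≢0 B k ⦄

  ≤-÷B^ : ∀ x y k → y * B ^ k ≤ x → y ≤ x ÷B^ k
  ≤-÷B^ x y k le = ≤-trans
    (≤-reflexive (sym (m*n/n≡m y (B ^ k) ⦃ m^n≢0 B k ⦄)))
    (/-monoˡ-≤ (B ^ k) ⦃ m^n≢0 B k ⦄ le)

  ≤-<-÷B^ : ∀ x y k → x ÷B^ k ℕ.< y → x ≤ B ^ k * y
  ≤-<-÷B^ x y k lt with x ≤? B ^ k * y
  ... | yes le = le
  ... | no  ≰  = contradiction
    (≤-÷B^ x y k (≤-trans (≤-reflexive (*-comm y (B ^ k))) (<⇒≤ (≰⇒> ≰)))) (<⇒≱ lt)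

  -- Obstructions and their peeling

  threshold : ℕ → ℕ
  -- The extra factor `B` absorbs the 4 that is lost when passing from average to maximum degree.
  threshold t = d ÷B^ suc ((4 + e t) * q)

  -- `I` is what a reservoir of size `d / B ^ e t` yields after losing half of its vertices and a
  -- factor `B` for stability, whence the exponent `2 + e t`.
  record Obstruction (t : ℕ) (R : V) : Set₁ where
    field
      I Z     : V
      I⊆R     : I ⊆ R
      stable  : IsStable G I
      large   : d ≤ B ^ (2 + e t) * card I
      I-small : card I ≤ d
      Z-small : card (Z ∩ X) ≤ B * d
      sparse  : ∀ s → s ∈ I → card (N G s ∩ (R ∖ Z)) ≤ threshold t

  -- Removing `Z` and `I` costs at most `2 * B * d` vertices; twice this cost, expressed through
  -- `card I`, is at most `weight t * card I`.
  weight : ℕ → ℕ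
  weight t = 4 * B ^ (3 + e t)

  -- `Y t` collects the stable sets of the obstructions of type `t` peeled off so far. In `cover`
  -- the term `card X` stands for the part left over, at most half of `X`.
  record Peeling (R : V) : Set₁ where
    field
      Y      : Fin h → V
      Y⊆R    : ∀ t → Y t ⊆ R
      sparse : ∀ t → degreeSum G (Y t) ≤ 2 * threshold (toℕ t) * card (Y t)
      cover  : 2 * card R ≤ card X + ∑ full λ t → weight (toℕ t) * card (Y t)

  16≤B : 16 ≤ B
  16≤B = ≤-trans (*-monoʳ-≤ 16 (s≤s {0} {h} z≤n)) 16[1+h]≤B

  B^k≤d : ∀ {k} → k ≤ suc (exponent q h) → B ^ k ≤ d
  B^k≤d le = ≤-trans (^-monoʳ-≤ B le) B^≤d

  1≤d : 1 ≤ d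
  1≤d = B^k≤d {0} z≤n

  obstruction-card : ∀ {t R} (o : Obstruction t R) → R ⊆ X → let open Obstruction o in
                     2 * card (R ∩ (Z ∪ I)) ≤ weight t * card I
  obstruction-card {t} {R} o R⊆X = begin
    2 * card (R ∩ (Z ∪ I))          ≤⟨ *-monoʳ-≤ 2 (∑-cover (R ∩ (Z ∪ I)) (Z ∩ X) I _ λ where
                                         x (x∈R , inj₁ x∈Z) → inj₁ (x∈Z , R⊆X x x∈R)
                                         x (x∈R , inj₂ x∈I) → inj₂ x∈I) ⟩
    2 * (card (Z ∩ X) + card I)     ≤⟨ *-monoʳ-≤ 2 (+-mono-≤ Z-small
                                         (≤-trans I-small (m≤n*m d B))) ⟩
    2 * (B * d + B * d)             ≡⟨ double (B * d) ⟩
    4 * (B * d)                     ≤⟨ *-monoʳ-≤ 4 (*-monoʳ-≤ B large) ⟩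
    4 * (B * (B ^ (2 + e t) * i))   ≡⟨ regroup B (B ^ (2 + e t)) i ⟩
    weight t * i                    ∎
    where
    open Obstruction o
    open ≤-Reasoning
    i = card I
    double : ∀ a → 2 * (a + a) ≡ 4 * a
    double = solve-∀
    regroup : ∀ a b c → 4 * (a * (b * c)) ≡ 4 * (a * b) * c
    regroup = solve-∀

  -- The decision is an argument so that each property of the extended family can be proved by
  -- matching on it.
  extend : {A : Set} → Dec A → V → V → V
  extend (yes _) P Q = P ∪ Q
  extend (no _)  P Q = P

  peel-step : ∀ {R} (t : Fin h) (o : Obstruction (toℕ t) R) → let open Obstruction o in
              R ⊆ X → Peeling (R ∖ (Z ∪ I)) → Peeling R
  peel-step {R} t o R⊆X p = record
    { Y      = λ s → extend (s Fin.≟ t) (P.Y s) O.I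
    ; Y⊆R    = λ s → ext⊆ (s Fin.≟ t)
    ; sparse = λ s → ext-sparse (s Fin.≟ t)
    ; cover  = begin
        2 * card R
          ≤⟨ *-monoʳ-≤ 2 (card-∖ R (O.Z ∪ O.I)) ⟩
        2 * (card (R ∩ (O.Z ∪ O.I)) + card R′)
          ≡⟨ *-distribˡ-+ 2 (card (R ∩ (O.Z ∪ O.I))) (card R′) ⟩
        2 * card (R ∩ (O.Z ∪ O.I)) + 2 * card R′
          ≤⟨ +-mono-≤ (obstruction-card o R⊆X) P.cover ⟩
        x + (card X + s)
          ≡⟨ +-comm x _ ⟩
        (card X + s) + x
          ≡⟨ +-assoc (card X) s x ⟩
        card X + (s + x)
          ≤⟨ +-monoʳ-≤ (card X) (∑-increase _ _ t x
               (λ j → *-monoʳ-≤ (weight (toℕ j)) (ext-≥ (j Fin.≟ t)))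
               (≤-trans (≤-reflexive (sym (*-distribˡ-+ (weight (toℕ t)) _ _)))
                        (*-monoʳ-≤ (weight (toℕ t)) (ext-+ (t Fin.≟ t))))) ⟩
        card X + ∑ full (λ s → weight (toℕ s) * card (extend (s Fin.≟ t) (P.Y s) O.I))
          ∎
    }
    where
    module O = Obstruction o
    module P = Peeling p
    open ≤-Reasoning
    R′ = R ∖ (O.Z ∪ O.I)
    x = weight (toℕ t) * card O.I
    s = ∑ full λ t → weight (toℕ t) * card (P.Y t)
    disjoint : ∀ s y → y ∈ P.Y s → ¬ y ∈ O.I
    disjoint s y y∈Y y∈I = proj₂ (P.Y⊆R s y y∈Y) (inj₂ y∈I)
    ext⊆ : ∀ {s} (eq? : Dec (s ≡ t)) → extend eq? (P.Y s) O.I ⊆ R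
    ext⊆ {s} (yes _) y (inj₁ y∈Y) = proj₁ (P.Y⊆R s y y∈Y)
    ext⊆ {s} (yes _) y (inj₂ y∈I) = O.I⊆R y y∈I
    ext⊆ {s} (no _)  y y∈Y        = proj₁ (P.Y⊆R s y y∈Y)
    ext-sparse : ∀ {s} (eq? : Dec (s ≡ t)) → degreeSum G (extend eq? (P.Y s) O.I) ≤
                 2 * threshold (toℕ s) * card (extend eq? (P.Y s) O.I)
    ext-sparse {s} (no _)     = P.sparse s
    -- The sets already in `Y t` were found outside `Z`, so the sparsity of the obstruction bounds
    -- the neighbours of `I` among them.
    ext-sparse     (yes refl) = degreeSum-∪ G (P.Y t) O.I (threshold (toℕ t)) O.stable (disjoint t)
      (λ v v∈I → ≤-trans
        (card-mono (N G v ∩ P.Y t) (N G v ∩ (R ∖ O.Z)) λ where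
          y (vy , y∈Y) → vy , proj₁ (P.Y⊆R t y y∈Y) , λ y∈Z → proj₂ (P.Y⊆R t y y∈Y) (inj₁ y∈Z))
        (O.sparse v v∈I))
      (P.sparse t)
    ext-≥ : ∀ {s} (eq? : Dec (s ≡ t)) → card (P.Y s) ≤ card (extend eq? (P.Y s) O.I)
    ext-≥ {s} (yes _) = card-mono (P.Y s) (P.Y s ∪ O.I) λ _ → inj₁
    ext-≥     (no _)  = ≤-refl
    ext-+ : (eq? : Dec (t ≡ t)) → card (P.Y t) + card O.I ≤ card (extend eq? (P.Y t) O.I)
    ext-+ (yes _)  = ∑-disjoint (P.Y t) O.I (P.Y t ∪ O.I) _ (λ _ → inj₁) (λ _ → inj₂) (disjoint t)
    ext-+ (no t≢t) = contradiction refl t≢t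

  -- Induction on a bound `b` for the size of `R`. Obstructions are supplied only under double
  -- negation, which suffices because the final goal is a contradiction.
  peel : (∀ R → R ⊆ X → card X ≤ 2 * card R → ¬ ¬ (∃[ t ] Obstruction (toℕ {h} t) R)) →
         ∀ b R → card R ≤ b → R ⊆ X → ¬ ¬ Peeling R
  peel obstructed b R R≤b R⊆X ¬p with 2 * card R ≤? card X
  ... | yes small = ¬p record
    { Y      = λ _ → ∅
    ; Y⊆R    = λ _ _ ()
    ; sparse = λ _ → ≤-trans (≤-reflexive (∑-∅ (order G) _)) z≤n
    ; cover  = ≤-trans small (m≤m+n (card X) _)
    }
  peel obstructed zero R R≤b R⊆X ¬p | no big =
    big (≤-trans (*-monoʳ-≤ 2 R≤b) z≤n)
  peel obstructed (suc b) R R≤b R⊆X ¬p | no big =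
    obstructed R R⊆X (<⇒≤ (≰⇒> big)) λ { (t , o) →
      let open Obstruction o in
      peel obstructed b (R ∖ (Z ∪ I)) (≤-pred (≤-trans (shrink o) R≤b)) (λ x x∈ → R⊆X x (proj₁ x∈))
        λ p → ¬p (peel-step t o R⊆X p) }
    where
    shrink : ∀ {t} (o : Obstruction t R) → let open Obstruction o in
             suc (card (R ∖ (Z ∪ I))) ≤ card R
    shrink {t} o = ≤-trans (+-monoˡ-≤ _ 1≤I)
      (∑-disjoint I (R ∖ (Z ∪ I)) R _ I⊆R (λ _ → proj₁) λ x x∈I x∈ → proj₂ x∈ (inj₂ x∈I))
      where
      open Obstruction o
      1≤I : 1 ≤ card I
      1≤I with card I | large
      ... | zero  | le = contradiction (≤-trans 1≤d (≤-trans le (≤-reflexive (*-zeroʳ (B ^ (2 + e t)))))) λ ()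
      ... | suc _ | _  = s≤s z≤n

  -- Otherwise half of `Y` forms a set `L` of size at least `card X / B ^ (4 + e t)` with maximum
  -- degree at most `d′`, which criticality forbids.
  degenerate-small : ∀ t Y → t ℕ.< h → Y ⊆ X → degreeSum G Y ≤ 2 * threshold t * card Y →
                     2 * suc h * (weight t * card Y) ≤ card X
  degenerate-small t Y t<h Y⊆X sum≤ with 2 * suc h * (weight t * card Y) ≤? card X
  ... | yes le = le
  ... | no ≰   = contradiction
    (critical L d′ (λ x x∈L → Y⊆X x (proj₁ x∈L)) 1≤d′ d′<d low)
    (≤⇒≯ bound)
    where
    open ≤-Reasoning
    k = (4 + e t) * q
    -- With this choice `(d′ / d) ^ (1 / q)` is at most `1 / B ^ (4 + e t)`, the proportion of `X`
    -- that `L` would occupy.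
    d′ = d ÷B^ k
    b = threshold t
    L = lowDegree G Y (4 * b)
    k<E : suc k ≤ suc (exponent q h)
    k<E = ≤-trans (n≤1+n _) (≤-trans (exponent-mono q t<h) (n≤1+n _))
    1≤d′ : 1 ≤ d′
    1≤d′ = ≤-÷B^ d 1 k (≤-trans (≤-reflexive (*-identityˡ _)) (B^k≤d (≤-trans (n≤1+n k) k<E)))
    2≤B^k : 2 ≤ B ^ k
    2≤B^k = ≤-trans (≤-trans (s≤s (s≤s z≤n)) 16≤B) (≤-trans (≤-reflexive (sym (*-identityʳ B)))
      (^-monoʳ-≤ B {1} {k} (≤-trans (s≤s z≤n) (m≤m*n (4 + e t) q))))
    d′<d : d′ ℕ.< d
    d′<d = begin
      suc d′      ≡⟨ +-comm 1 d′ ⟩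
      d′ + 1      ≤⟨ +-monoʳ-≤ d′ 1≤d′ ⟩
      d′ + d′     ≡⟨ cong (d′ +_) (+-identityʳ d′) ⟨
      2 * d′      ≡⟨ *-comm 2 d′ ⟩
      d′ * 2      ≤⟨ *-monoʳ-≤ d′ 2≤B^k ⟩
      d′ * B ^ k  ≤⟨ ÷B^-* d k ⟩
      d           ∎
    4b≤d′ : 4 * b ≤ d′
    4b≤d′ = ≤-÷B^ d (4 * b) k (begin
      4 * b * B ^ k    ≤⟨ *-monoˡ-≤ (B ^ k) (*-monoˡ-≤ b (≤-trans (s≤s (s≤s (s≤s (s≤s z≤n)))) 16≤B)) ⟩
      B * b * B ^ k    ≡⟨ cong (_* B ^ k) (*-comm B b) ⟩
      b * B * B ^ k    ≡⟨ *-assoc b B (B ^ k) ⟩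
      b * B ^ suc k    ≤⟨ ÷B^-* d (suc k) ⟩
      d                ∎)
    low : MaxDegree≤ G L d′
    low v (v∈Y , le) = ≤-trans
      (card-mono (N G v ∩ L) (N G v ∩ Y) λ { x (vx , x∈Y , _) → vx , x∈Y })
      (≤-trans le 4b≤d′)
    X≤L : card X ≤ B ^ (4 + e t) * card L
    X≤L = begin
      card X                                       ≤⟨ <⇒≤ (≰⇒> ≰) ⟩
      2 * suc h * (weight t * card Y)              ≤⟨ *-monoʳ-≤ (2 * suc h) (*-monoʳ-≤ (weight t)
                                                        (lowDegree-half G Y b sum≤)) ⟩
      2 * suc h * (weight t * (2 * card L))        ≡⟨ regroup (suc h) (B ^ (3 + e t)) (card L) ⟩
      16 * suc h * B ^ (3 + e t) * card L          ≤⟨ *-monoˡ-≤ (card L) (*-monoˡ-≤ (B ^ (3 + e t)) 16[1+h]≤B) ⟩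
      B ^ (4 + e t) * card L                       ∎
      where
      regroup : ∀ h b l → 2 * h * (4 * b * (2 * l)) ≡ 16 * h * b * l
      regroup = solve-∀
    bound : card X ^ q * d′ ≤ card L ^ q * d
    bound = begin
      card X ^ q * d′                           ≤⟨ *-monoˡ-≤ d′ (^-monoˡ-≤ q X≤L) ⟩
      (B ^ (4 + e t) * card L) ^ q * d′         ≡⟨ cong (_* d′) (^-distribʳ-* (B ^ (4 + e t)) (card L) q) ⟩
      (B ^ (4 + e t)) ^ q * card L ^ q * d′     ≡⟨ cong (λ z → z * card L ^ q * d′) (^-*-assoc B (4 + e t) q) ⟩
      B ^ k * card L ^ q * d′                   ≡⟨ regroup (B ^ k) (card L ^ q) d′ ⟩
      card L ^ q * (d′ * B ^ k)                 ≤⟨ *-monoʳ-≤ (card L ^ q) (÷B^-* d k) ⟩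
      card L ^ q * d                            ∎
      where
      regroup : ∀ x y z → x * y * z ≡ y * (z * x)
      regroup = solve-∀

  -- If all large sets were obstructed, peeling `X` would give `card X ≤ ∑ full g`. But each of the
  -- `h` terms is at most `card X / (2 * suc h)`, so the sum is below `card X`.
  unobstructed : ¬ ¬ (∃[ U ] (U ⊆ X × card X ≤ 2 * card U × (∀ t → t ℕ.< h → ¬ Obstruction t U)))
  unobstructed ¬u = peel
    (λ R R⊆X big ¬o → ¬u (R , R⊆X , big , λ t t<h o →
      ¬o (fromℕ< t<h , subst (λ s → Obstruction s R) (sym (Fin.toℕ-fromℕ< t<h)) o)))
    (card X) X ≤-refl (λ _ x∈X → x∈X) absurd
    where
    open ≤-Reasoning
    absurd : ¬ Peeling X
    absurd p = <⇒≱ (s≤s 1≤n) (+-cancelˡ-≤ (h * card X) _ _ (begin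
      h * card X + suc (card X)      ≤⟨ +-monoʳ-≤ (h * card X) (+-monoˡ-≤ (card X) (≤-trans 1≤n (m≤n+m (card X) (h * card X)))) ⟩
      h * card X + (h * card X + card X + card X)
                                     ≡⟨ regroup h (card X) ⟩
      2 * suc h * card X             ≤⟨ *-monoʳ-≤ (2 * suc h) X≤∑ ⟩
      2 * suc h * ∑ full g           ≡⟨ *-∑ full (2 * suc h) g ⟩
      (∑ full λ t → 2 * suc h * g t) ≤⟨ ∑-bound full _ (card X) (λ t _ →
                                          degenerate-small (toℕ t) (P.Y t) (Fin.toℕ<n t) (P.Y⊆R t) (P.sparse t)) ⟩
      card X * card (full {h})       ≡⟨ cong (card X *_) (card-full h) ⟩
      card X * h                     ≡⟨ *-comm (card X) h ⟩
      h * card X                     ≤⟨ m≤m+n (h * card X) 1 ⟩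
      h * card X + 1                 ∎))
      where
      module P = Peeling p
      g : Fin h → ℕ
      g t = weight (toℕ t) * card (P.Y t)
      regroup : ∀ h x → h * x + (h * x + x + x) ≡ 2 * suc h * x
      regroup = solve-∀
      X≤∑ : card X ≤ ∑ full g
      X≤∑ = +-cancelˡ-≤ (card X) (card X) (∑ full g)
        (≤-trans (≤-reflexive (cong (card X +_) (sym (+-identityʳ (card X))))) P.cover)

  -- Embedding the forest

  links : V → V → ℕ
  links P Q = ∑ P λ x → card (N[_] G x ∩ Q)

  links-sym : ∀ P Q → links P Q ≡ links Q P
  links-sym = ∑-incidence (N[_] G) (N[]-sym G)

  links-mono : ∀ P P′ Q Q′ → P ⊆ P′ → Q ⊆ Q′ → links P Q ≤ links P′ Q′
  links-mono P P′ Q Q′ P⊆P′ Q⊆Q′ = ∑-mono P P′ λ x x∈P → P⊆P′ x x∈P ,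
    card-mono (N[_] G x ∩ Q) (N[_] G x ∩ Q′) λ { y (xy , y∈Q) → xy , Q⊆Q′ y y∈Q }

  -- The sparsity weight before the first step. Each of the `h` steps divides it by 4, so that it
  -- never falls below the `4 * suc h` needed to choose a child.
  W : ℕ
  W = 4 ^ h * (4 * suc h)

  module Embed
    (U : V) (U⊆X : U ⊆ X) (X≤2U : card X ≤ 2 * card U)
    (unobstructed : ∀ t → t ℕ.< h → ¬ Obstruction t U)
    (4^q≤B : 4 ^ q ≤ B) (W≤B : 2 * suc h * suc W ≤ B) (4Bd≤n : 4 * (B * d) ≤ card X)
    where

    -- M i is the reservoir from which the children of i are chosen. As links
    -- counts closed neighbourhoods, sparse with i ≡ j says that choosing one
    -- child of i leaves most of M i available for the next.
    record State (D : FinSet h) (t w : ℕ) : Set₁ where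
      field
        f        : Vertex H → Vertex G
        M        : Vertex H → V
        f∈X      : ∀ i → i ∈ D → f i ∈ X
        M⊆N      : ∀ i → i ∈ D → M i ⊆ N G (f i)
        M⊆U      : ∀ i → i ∈ D → M i ⊆ U
        large    : ∀ i → i ∈ D → d ≤ B ^ e t * card (M i)
        inj      : ∀ i j → i ∈ D → j ∈ D → f i ≡ f j → i ≡ j
        adj⇒     : ∀ i j → i ∈ D → j ∈ D → Adj H i j → Adj G (f i) (f j)
        adj⇐     : ∀ i j → i ∈ D → j ∈ D → Adj G (f i) (f j) → Adj H i j
        far      : ∀ i j → i ∈ D → j ∈ D → i ≢ j → ∀ x → x ∈ M i → ¬ x ∈ N[_] G (f j)
        sparse   : ∀ i j → i ∈ D → j ∈ D → w * links (M i) (M j) ≤ card (M i) * card (M j)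

    update : {A : Set₁} {B : Set} → Dec B → A → A → A
    update (yes _) x y = x
    update (no _)  x y = y

    update₀ : {A B : Set} → Dec B → A → A → A
    update₀ (yes _) x y = x
    update₀ (no _)  x y = y

    suc-W≤B : suc W ≤ B
    suc-W≤B = ≤-trans (m≤n*m (suc W) (2 * suc h)) W≤B

    -- One vertex is added. The weight falls from `4 * w` to `w` because each of the two reservoirs
    -- in a pair may lose half of its vertices.
    module Step
      {D : FinSet h} {t w : ℕ} (t<h : t ℕ.< h) (S : State D t (4 * w))
      (w≤W : 4 * w ≤ W) (h≤w : 4 * suc h ≤ 4 * w)
      where

      open State S
      open ≤-Reasoning

      M-positive : ∀ i → i ∈ D → 1 ≤ card (M i)
      M-positive i i∈D with card (M i) | large i i∈D
      ... | zero  | le = contradiction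
        (≤-trans 1≤d (≤-trans le (≤-reflexive (*-zeroʳ (B ^ e t))))) λ ()
      ... | suc _ | _  = s≤s z≤n

      -- Vertices that see at least a fraction `1 / (4 * w)` of the reservoir of `i`. Keeping new
      -- reservoirs out of every crowd makes them sparse to the old ones.
      Crowd : Vertex H → V
      Crowd i = ⟅ (λ y → card (M i) ≤? 4 * w * card (N[_] G y ∩ M i)) ⟆

      Zᵢ : Vertex H → V
      Zᵢ i = ⟅ (λ y → member? D i ×-dec (member? (N[_] G (f i) ∪ Crowd i) y ×-dec member? X y)) ⟆

      Z : V
      Z = ⋃ Zᵢ

      -- Double counting: each member of `M i` is linked to at most `suc d` vertices of `X`, while
      -- each crowd vertex takes up a fraction `1 / (4 * w)` of `M i`.
      crowd-small : ∀ i → i ∈ D → card (Crowd i ∩ X) ≤ 4 * w * suc d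
      crowd-small i i∈D = *-cancelˡ-≤ (card (M i)) ⦃ ℕ.>-nonZero (M-positive i i∈D) ⦄ (begin
        card (M i) * card (Crowd i ∩ X)
          ≤⟨ markov (Crowd i ∩ X) X _ (card (M i)) (λ { x (le , x∈X) → x∈X , le }) ⟩
        ∑ X (λ y → 4 * w * card (N[_] G y ∩ M i))
          ≡⟨ *-∑ X (4 * w) _ ⟨
        4 * w * links X (M i)
          ≡⟨ cong (4 * w *_) (links-sym X (M i)) ⟩
        4 * w * links (M i) X
          ≤⟨ *-monoʳ-≤ (4 * w) (∑-bound (M i) _ (suc d) λ y y∈M →
               card-N[] G X deg y (U⊆X y (M⊆U i i∈D y y∈M))) ⟩
        4 * w * (suc d * card (M i))
          ≡⟨ *-assoc (4 * w) (suc d) (card (M i)) ⟨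
        4 * w * suc d * card (M i)
          ≡⟨ *-comm (4 * w * suc d) (card (M i)) ⟩
        card (M i) * (4 * w * suc d)  ∎)

      Zᵢ-small : ∀ i → Dec (i ∈ D) → 1 * card (Zᵢ i) ≤ suc (4 * w) * suc d
      Zᵢ-small i (yes i∈D) = begin
        1 * card (Zᵢ i)                                ≡⟨ *-identityˡ _ ⟩
        card (Zᵢ i)                                    ≤⟨ ∑-cover (Zᵢ i) (N[_] G (f i) ∩ X) (Crowd i ∩ X) _ (λ where
                                                            x (_ , inj₁ fx , x∈X) → inj₁ (fx , x∈X)
                                                            x (_ , inj₂ le , x∈X) → inj₂ (le , x∈X)) ⟩
        card (N[_] G (f i) ∩ X) + card (Crowd i ∩ X)   ≤⟨ +-mono-≤ (card-N[] G X deg (f i) (f∈X i i∈D)) (crowd-small i i∈D) ⟩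
        suc (4 * w) * suc d                            ∎
      Zᵢ-small i (no i∉D) = begin
        1 * card (Zᵢ i)      ≡⟨ *-identityˡ _ ⟩
        card (Zᵢ i)          ≤⟨ card-mono (Zᵢ i) ∅ (λ x x∈ → i∉D (proj₁ x∈)) ⟩
        card (∅ {order G})   ≡⟨ ∑-∅ (order G) _ ⟩
        0                    ≤⟨ z≤n ⟩
        suc (4 * w) * suc d  ∎

      Z-small : card Z ≤ B * d
      Z-small = begin
        card Z                          ≡⟨ *-identityˡ (card Z) ⟨
        1 * card Z                      ≤⟨ card-⋃ 1 Zᵢ (λ i → Zᵢ-small i (member? D i)) ⟩
        h * (suc (4 * w) * suc d)       ≤⟨ *-mono-≤ (n≤1+n h) (*-mono-≤ (s≤s w≤W) (+-monoˡ-≤ d 1≤d)) ⟩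
        suc h * (suc W * (d + d))       ≡⟨ regroup (suc h) (suc W) d ⟩
        2 * suc h * suc W * d           ≤⟨ *-monoˡ-≤ d W≤B ⟩
        B * d                           ∎
        where
        regroup : ∀ a b c → a * (b * (c + c)) ≡ 2 * a * b * c
        regroup = solve-∀

      R : V
      R = U ∖ Z

      -- A possible image of the new vertex, `E` being its adjacency to `D` in `H`. `spread` lets
      -- every old reservoir keep half after `z` is chosen, and `rich` provides the reservoir of `z`
      -- itself.
      record Candidate (E : Vertex H → Set) : Set where
        field
          z      : Vertex G
          z∈U    : z ∈ U
          spread : ∀ i → i ∈ D → 2 * card (N[_] G z ∩ M i) ≤ card (M i)
          rich   : threshold t ℕ.< card (N G z ∩ R)
          fresh  : ∀ i → i ∈ D → z ≢ f i
          edge   : ∀ i → i ∈ D → E i → Adj G z (f i)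
          nonedge : ∀ i → i ∈ D → Adj G z (f i) → E i

      R-avoids : ∀ {y} → y ∈ R → ∀ i → i ∈ D → ¬ y ∈ N[_] G (f i) × 4 * w * card (N[_] G y ∩ M i) ℕ.< card (M i)
      R-avoids {y} (y∈U , y∉Z) i i∈D =
        (λ fy → y∉Z (i , i∈D , inj₁ fy , U⊆X y y∈U)) ,
        ≰⇒> λ le → y∉Z (i , i∈D , inj₂ le , U⊆X y y∈U)

      -- Any vertex of `R` satisfies everything but `rich`. If none had more than `d / B` neighbours
      -- in `R`, then `R`, at least a quarter of `X`, would have maximum degree at most `d / B`,
      -- against criticality and `4 ^ q ≤ B`.
      isolatedCandidate : {E : Vertex H → Set} → (∀ i → i ∈ D → ¬ E i) → Candidate E
      isolatedCandidate {E} isolated with Fin.any? (λ z → member? R z ×-dec (d ÷B^ 1 <? card (N G z ∩ R)))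
      ... | yes (z , z∈R , rich) = record
        { z       = z
        ; z∈U     = proj₁ z∈R
        ; spread  = λ i i∈D → ≤-trans
            (*-monoˡ-≤ (card (N[_] G z ∩ M i)) (≤-trans (≤-trans (s≤s (s≤s z≤n)) (m≤m*n 4 (suc h))) h≤w))
            (<⇒≤ (proj₂ (R-avoids z∈R i i∈D)))
        ; rich    = ≤-<-trans threshold≤ rich
        ; fresh   = λ i i∈D z≡f → proj₁ (R-avoids z∈R i i∈D) (inj₁ (sym z≡f))
        ; edge    = λ i i∈D Ei → contradiction Ei (isolated i i∈D)
        ; nonedge = λ i i∈D zf → contradiction (inj₂ (Graph.symm G zf)) (proj₁ (R-avoids z∈R i i∈D))
        }
        where
        threshold≤ : threshold t ≤ d ÷B^ 1
        threshold≤ = ≤-÷B^ d (threshold t) 1 (≤-trans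
          (*-monoʳ-≤ (threshold t) (^-monoʳ-≤ B {1} {suc ((4 + e t) * q)} (s≤s z≤n)))
          (÷B^-* d (suc ((4 + e t) * q))))
      ... | no ∄z = contradiction
        (critical R (d ÷B^ 1) (λ x x∈R → U⊆X x (proj₁ x∈R)) 1≤ <d
          λ v v∈R → ≮⇒≥ λ lt → ∄z (v , v∈R , lt))
        (≤⇒≯ bound)
        where
        d′ = d ÷B^ 1
        1≤ : 1 ≤ d′
        1≤ = ≤-÷B^ d 1 1 (≤-trans (≤-reflexive (*-identityˡ _)) (B^k≤d {1} (s≤s z≤n)))
        2d′≤d : 2 * d′ ≤ d
        2d′≤d = begin
          2 * d′      ≡⟨ *-comm 2 d′ ⟩
          d′ * 2      ≤⟨ *-monoʳ-≤ d′ (≤-trans (s≤s (s≤s z≤n)) (≤-trans 16≤B (≤-reflexive (sym (*-identityʳ B))))) ⟩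
          d′ * B ^ 1  ≤⟨ ÷B^-* d 1 ⟩
          d           ∎
        <d : d′ ℕ.< d
        <d = ≤-trans (+-mono-≤ 1≤ (≤-reflexive (sym (+-identityʳ d′))))  2d′≤d
        X≤4R : card X ≤ 4 * card R
        X≤4R = +-cancelˡ-≤ (card X) (card X) (4 * card R) (begin
          card X + card X                ≤⟨ +-mono-≤ X≤2U X≤2U ⟩
          2 * card U + 2 * card U        ≡⟨ four (card U) ⟩
          4 * card U                     ≤⟨ *-monoʳ-≤ 4 (card-∖ U Z) ⟩
          4 * (card (U ∩ Z) + card R)    ≤⟨ *-monoʳ-≤ 4 (+-monoˡ-≤ (card R)
                                              (≤-trans (card-mono (U ∩ Z) Z λ _ → proj₂) Z-small)) ⟩
          4 * (B * d + card R)           ≡⟨ *-distribˡ-+ 4 (B * d) (card R) ⟩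
          4 * (B * d) + 4 * card R       ≤⟨ +-monoˡ-≤ _ 4Bd≤n ⟩
          card X + 4 * card R            ∎)
          where
          four : ∀ u → 2 * u + 2 * u ≡ 4 * u
          four = solve-∀
        bound : card X ^ q * d′ ≤ card R ^ q * d
        bound = begin
          card X ^ q * d′             ≤⟨ *-monoˡ-≤ d′ (^-monoˡ-≤ q X≤4R) ⟩
          (4 * card R) ^ q * d′       ≡⟨ cong (_* d′) (^-distribʳ-* 4 (card R) q) ⟩
          4 ^ q * card R ^ q * d′     ≤⟨ *-monoˡ-≤ d′ (*-monoˡ-≤ (card R ^ q) 4^q≤B) ⟩
          B * card R ^ q * d′         ≡⟨ regroup B (card R ^ q) d′ ⟩
          card R ^ q * (d′ * (B * 1)) ≤⟨ *-monoʳ-≤ (card R ^ q) (÷B^-* d 1) ⟩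
          card R ^ q * d              ∎
          where
          regroup : ∀ x y z → x * y * z ≡ y * (z * (x * 1))
          regroup = solve-∀

      -- The image is sought in the reservoir of the parent `p`. Sparsity against every reservoir,
      -- that of `p` included, makes at most half of `M p` bad. If nothing in the rest `S′` is rich,
      -- a stable subset of `S′` together with `Z` is an obstruction in `U`.
      childCandidate : {E : Vertex H → Set} (p : Vertex H) → p ∈ D → E p →
                       (∀ i → i ∈ D → E i → i ≡ p) → Candidate E
      childCandidate {E} p p∈D Ep unique = candidate
        where
        bad : Vertex H → V
        bad i = ⟅ (λ z → member? (M p) z ×-dec (member? D i ×-dec
                          (card (M i) <? 2 * card (N[_] G z ∩ M i)))) ⟆
        bad-small : ∀ i → Dec (i ∈ D) → 4 * w * card (bad i) ≤ 2 * card (M p)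
        bad-small i (no i∉D) = begin
          4 * w * card (bad i)         ≤⟨ *-monoʳ-≤ (4 * w) (card-mono (bad i) ∅ λ { x (_ , i∈D , _) → i∉D i∈D }) ⟩
          4 * w * card (∅ {order G})   ≡⟨ cong (4 * w *_) (∑-∅ (order G) _) ⟩
          4 * w * 0                    ≡⟨ *-zeroʳ (4 * w) ⟩
          0                            ≤⟨ z≤n ⟩
          2 * card (M p)               ∎
        bad-small i (yes i∈D) = *-cancelˡ-≤ (card (M i)) ⦃ ℕ.>-nonZero (M-positive i i∈D) ⦄ (begin
          card (M i) * (4 * w * card (bad i))
            ≡⟨ x∙yz≈y∙xz (card (M i)) (4 * w) (card (bad i)) ⟩
          4 * w * (card (M i) * card (bad i))
            ≤⟨ *-monoʳ-≤ (4 * w) (markov (bad i) (M p) _ (card (M i))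
                 λ { x (x∈M , _ , lt) → x∈M , <⇒≤ lt }) ⟩
          4 * w * (∑ (M p) λ z → 2 * card (N[_] G z ∩ M i))
            ≡⟨ cong (4 * w *_) (*-∑ (M p) 2 _) ⟨
          4 * w * (2 * links (M p) (M i))
            ≡⟨ x∙yz≈y∙xz (4 * w) 2 _ ⟩
          2 * (4 * w * links (M p) (M i))
            ≤⟨ *-monoʳ-≤ 2 (sparse p i p∈D i∈D) ⟩
          2 * (card (M p) * card (M i))
            ≡⟨ regroup 2 (card (M p)) (card (M i)) ⟩
          card (M i) * (2 * card (M p))  ∎)
          where
          regroup : ∀ a b c → a * (b * c) ≡ c * (a * b)
          regroup = solve-∀
          x∙yz≈y∙xz : ∀ x y z → x * (y * z) ≡ y * (x * z)
          x∙yz≈y∙xz = solve-∀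
        S′ : V
        S′ = M p ∖ ⋃ bad
        2bad≤M : 2 * card (⋃ bad) ≤ card (M p)
        2bad≤M = *-cancelˡ-≤ (2 * suc h) (begin
          2 * suc h * (2 * card (⋃ bad))  ≡⟨ regroup (suc h) (card (⋃ bad)) ⟩
          4 * suc h * card (⋃ bad)        ≤⟨ *-monoˡ-≤ (card (⋃ bad)) h≤w ⟩
          4 * w * card (⋃ bad)            ≤⟨ card-⋃ (4 * w) bad (λ i → bad-small i (member? D i)) ⟩
          h * (2 * card (M p))            ≤⟨ *-monoˡ-≤ (2 * card (M p)) (n≤1+n h) ⟩
          suc h * (2 * card (M p))        ≡⟨ regroup′ (suc h) (card (M p)) ⟩
          2 * suc h * card (M p)          ∎)
          where
          regroup : ∀ a b → 2 * a * (2 * b) ≡ 4 * a * b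
          regroup = solve-∀
          regroup′ : ∀ a b → a * (2 * b) ≡ 2 * a * b
          regroup′ = solve-∀
        M≤2S′ : card (M p) ≤ 2 * card S′
        M≤2S′ = half (card (M p)) (card (M p ∩ ⋃ bad)) (card S′) (card-∖ (M p) (⋃ bad)) (≤-trans
          (*-monoʳ-≤ 2 (card-mono (M p ∩ ⋃ bad) (⋃ bad) λ _ → proj₂)) 2bad≤M)
        candidate : Candidate E
        candidate with Fin.any? (λ z → member? S′ z ×-dec (threshold t <? card (N G z ∩ R)))
        ... | yes (z , (z∈M , z∉bad) , rich) = record
          { z       = z
          ; z∈U     = M⊆U p p∈D z z∈M
          ; spread  = λ i i∈D → ≮⇒≥ λ lt → z∉bad (i , z∈M , i∈D , lt)
          ; rich    = rich
          ; fresh   = fresh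
          ; edge    = λ i i∈D Ei → subst (λ i → Adj G z (f i)) (sym (unique i i∈D Ei))
                        (Graph.symm G (M⊆N p p∈D z z∈M))
          ; nonedge = nonedge
          }
          where
          fresh : ∀ i → i ∈ D → z ≢ f i
          fresh i i∈D z≡f with p Fin.≟ i
          ... | yes refl = Graph.irrefl G (sym z≡f) (M⊆N p p∈D z z∈M)
          ... | no p≢i   = far p i p∈D i∈D p≢i z z∈M (inj₁ (sym z≡f))
          nonedge : ∀ i → i ∈ D → Adj G z (f i) → E i
          nonedge i i∈D zf with p Fin.≟ i
          ... | yes refl = Ep
          ... | no p≢i   = contradiction (inj₂ (Graph.symm G zf)) (far p i p∈D i∈D p≢i z z∈M)
        ... | no ∄z with local (f p) S′ (f∈X p p∈D)
                (λ { x (x∈M , _) → M⊆N p p∈D x x∈M , U⊆X x (M⊆U p p∈D x x∈M) })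
        ... | I , I⊆S′ , I-stable , S′≤ = contradiction (record
          { I       = I
          ; Z       = Z
          ; I⊆R     = λ x x∈I → M⊆U p p∈D x (proj₁ (I⊆S′ x x∈I))
          ; stable  = I-stable
          ; large   = begin
              d                              ≤⟨ large p p∈D ⟩
              B ^ e t * card (M p)           ≤⟨ *-monoʳ-≤ (B ^ e t) (≤-trans M≤2S′ (*-monoʳ-≤ 2 S′≤)) ⟩
              B ^ e t * (2 * (B * card I))   ≤⟨ *-monoʳ-≤ (B ^ e t) (*-monoˡ-≤ (B * card I)
                                                  (≤-trans (s≤s (s≤s z≤n)) 16≤B)) ⟩
              B ^ e t * (B * (B * card I))   ≡⟨ regroup (B ^ e t) B (card I) ⟩
              B ^ (2 + e t) * card I         ∎
          ; I-small = ≤-trans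
              (card-mono I (N G (f p) ∩ X) λ x x∈I →
                M⊆N p p∈D x (proj₁ (I⊆S′ x x∈I)) , U⊆X x (M⊆U p p∈D x (proj₁ (I⊆S′ x x∈I))))
              (deg (f p) (f∈X p p∈D))
          ; Z-small = ≤-trans (card-mono (Z ∩ X) Z λ _ → proj₁) Z-small
          ; sparse  = λ s s∈I → ≮⇒≥ λ lt → ∄z (s , I⊆S′ s s∈I , lt)
          }) (unobstructed t t<h)
          where
          regroup : ∀ a b c → a * (b * (b * c)) ≡ b * (b * a) * c
          regroup = solve-∀

      -- The reservoir of the new vertex is a stable set `I` extracted from the neighbours of `z` in
      -- `R`; the old reservoirs give up the closed neighbourhood of `z`.
      place : ∀ {D⁺ : FinSet h} {u} → ¬ u ∈ D → (∀ i → i ∈ D⁺ → i ≢ u → i ∈ D) →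
              Candidate (Adj H u) → State D⁺ (suc t) w
      place {D⁺} {u} u∉D D⁺⊆ cand
        with local (Candidate.z cand) (N G (Candidate.z cand) ∩ R) (U⊆X _ (Candidate.z∈U cand))
               (λ { x (zx , x∈R) → zx , U⊆X x (proj₁ x∈R) })
      ... | I , I⊆ , I-stable , R≤ = record
        { f      = λ i → update₀ (i Fin.≟ u) z (f i)
        ; M      = λ i → update (i Fin.≟ u) I (M′ i)
        ; f∈X    = λ i i∈ → f∈X⁺ (i Fin.≟ u) i∈
        ; M⊆N    = λ i i∈ → M⊆N⁺ (i Fin.≟ u) i∈
        ; M⊆U    = λ i i∈ → M⊆U⁺ (i Fin.≟ u) i∈
        ; large  = λ i i∈ → large⁺ (i Fin.≟ u) i∈
        ; inj    = λ i j i∈ j∈ → inj⁺ (i Fin.≟ u) (j Fin.≟ u) i∈ j∈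
        ; adj⇒   = λ i j i∈ j∈ → adj⇒⁺ (i Fin.≟ u) (j Fin.≟ u) i∈ j∈
        ; adj⇐   = λ i j i∈ j∈ → adj⇐⁺ (i Fin.≟ u) (j Fin.≟ u) i∈ j∈
        ; far    = λ i j i∈ j∈ → far⁺ (i Fin.≟ u) (j Fin.≟ u) i∈ j∈
        ; sparse = λ i j i∈ j∈ → sparse⁺ (i Fin.≟ u) (j Fin.≟ u) i∈ j∈
        }
        where
        open Candidate cand
        old : ∀ {i} → i ∈ D⁺ → i ≢ u → i ∈ D
        old = D⁺⊆ _
        M′ : Vertex H → V
        M′ i = M i ∖ N[_] G z
        I⊆N : I ⊆ N G z
        I⊆N x x∈I = proj₁ (I⊆ x x∈I)
        I⊆R : I ⊆ R
        I⊆R x x∈I = proj₂ (I⊆ x x∈I)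
        M≤2M′ : ∀ i → i ∈ D → card (M i) ≤ 2 * card (M′ i)
        M≤2M′ i i∈D = half (card (M i)) (card (M i ∩ N[_] G z)) (card (M′ i)) (card-∖ (M i) (N[_] G z))
          (≤-trans (*-monoʳ-≤ 2 (card-mono (M i ∩ N[_] G z) (N[_] G z ∩ M i) λ { _ (a , b) → b , a }))
                   (spread i i∈D))
        d≤I : d ≤ B ^ e (suc t) * card I
        d≤I = begin
          d                                       ≤⟨ ≤-<-÷B^ d (card (N G z ∩ R)) (suc k) rich ⟩
          B ^ suc k * card (N G z ∩ R)            ≤⟨ *-monoʳ-≤ (B ^ suc k) R≤ ⟩
          B ^ suc k * (B * card I)                ≡⟨ regroup (B ^ suc k) B (card I) ⟩
          B ^ e (suc t) * card I                  ∎
          where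
          k = (4 + e t) * q
          regroup : ∀ a b c → a * (b * c) ≡ b * a * c
          regroup = solve-∀
        -- The lower bound on `d` has a power of `B` to spare beyond `d≤I`, so even `B ≤ card I`.
        -- This pays for each vertex of `I` being linked to itself.
        w≤I : w ≤ card I
        w≤I = ≤-trans (≤-trans (m≤n*m w 4) (≤-trans w≤W (≤-trans (n≤1+n W) suc-W≤B)))
          (*-cancelˡ-≤ (B ^ e (suc t)) ⦃ m^n≢0 B (e (suc t)) ⦄ (begin
            B ^ e (suc t) * B        ≡⟨ *-comm (B ^ e (suc t)) B ⟩
            B ^ suc (e (suc t))      ≤⟨ B^k≤d (s≤s (exponent-mono q t<h)) ⟩
            d                        ≤⟨ d≤I ⟩
            B ^ e (suc t) * card I   ∎))
        f∈X⁺ : ∀ {i} (i? : Dec (i ≡ u)) → i ∈ D⁺ → update₀ i? z (f i) ∈ X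
        f∈X⁺ (yes _)  _  = U⊆X z z∈U
        f∈X⁺ (no i≢u) i∈ = f∈X _ (old i∈ i≢u)
        M⊆N⁺ : ∀ {i} (i? : Dec (i ≡ u)) → i ∈ D⁺ → update i? I (M′ i) ⊆ N G (update₀ i? z (f i))
        M⊆N⁺ (yes _)  _  x x∈ = I⊆N x x∈
        M⊆N⁺ (no i≢u) i∈ x x∈ = M⊆N _ (old i∈ i≢u) x (proj₁ x∈)
        M⊆U⁺ : ∀ {i} (i? : Dec (i ≡ u)) → i ∈ D⁺ → update i? I (M′ i) ⊆ U
        M⊆U⁺ (yes _)  _  x x∈ = proj₁ (I⊆R x x∈)
        M⊆U⁺ (no i≢u) i∈ x x∈ = M⊆U _ (old i∈ i≢u) x (proj₁ x∈)
        large⁺ : ∀ {i} (i? : Dec (i ≡ u)) → i ∈ D⁺ → d ≤ B ^ e (suc t) * card (update i? I (M′ i))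
        large⁺     (yes _)  _  = d≤I
        large⁺ {i} (no i≢u) i∈ = begin
          d                              ≤⟨ large i (old i∈ i≢u) ⟩
          B ^ e t * card (M i)           ≤⟨ *-monoʳ-≤ (B ^ e t) (M≤2M′ i (old i∈ i≢u)) ⟩
          B ^ e t * (2 * card (M′ i))    ≤⟨ *-monoʳ-≤ (B ^ e t) (*-monoˡ-≤ (card (M′ i)) (≤-trans (s≤s (s≤s z≤n)) 16≤B)) ⟩
          B ^ e t * (B * card (M′ i))    ≡⟨ regroup (B ^ e t) B (card (M′ i)) ⟩
          B ^ suc (e t) * card (M′ i)    ≤⟨ *-monoˡ-≤ (card (M′ i)) (^-monoʳ-≤ B (exponent-step q t)) ⟩
          B ^ e (suc t) * card (M′ i)    ∎
          where
          regroup : ∀ a b c → a * (b * c) ≡ b * a * c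
          regroup = solve-∀
        inj⁺ : ∀ {i j} (i? : Dec (i ≡ u)) (j? : Dec (j ≡ u)) → i ∈ D⁺ → j ∈ D⁺ →
               update₀ i? z (f i) ≡ update₀ j? z (f j) → i ≡ j
        inj⁺ (yes refl) (yes refl) _  _  _  = refl
        inj⁺ (yes refl) (no j≢u)   _  j∈ eq = contradiction eq (fresh _ (old j∈ j≢u))
        inj⁺ (no i≢u)   (yes refl) i∈ _  eq = contradiction (sym eq) (fresh _ (old i∈ i≢u))
        inj⁺ (no i≢u)   (no j≢u)   i∈ j∈ eq = inj _ _ (old i∈ i≢u) (old j∈ j≢u) eq
        adj⇒⁺ : ∀ {i j} (i? : Dec (i ≡ u)) (j? : Dec (j ≡ u)) → i ∈ D⁺ → j ∈ D⁺ →
                Adj H i j → Adj G (update₀ i? z (f i)) (update₀ j? z (f j))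
        adj⇒⁺ (yes refl) (yes refl) _  _  ij = contradiction ij (Graph.irrefl H refl)
        adj⇒⁺ (yes refl) (no j≢u)   _  j∈ ij = edge _ (old j∈ j≢u) ij
        adj⇒⁺ (no i≢u)   (yes refl) i∈ _  ij = Graph.symm G (edge _ (old i∈ i≢u) (Graph.symm H ij))
        adj⇒⁺ (no i≢u)   (no j≢u)   i∈ j∈ ij = adj⇒ _ _ (old i∈ i≢u) (old j∈ j≢u) ij
        adj⇐⁺ : ∀ {i j} (i? : Dec (i ≡ u)) (j? : Dec (j ≡ u)) → i ∈ D⁺ → j ∈ D⁺ →
                Adj G (update₀ i? z (f i)) (update₀ j? z (f j)) → Adj H i j
        adj⇐⁺ (yes refl) (yes refl) _  _  zz = contradiction zz (Graph.irrefl G refl)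
        adj⇐⁺ (yes refl) (no j≢u)   _  j∈ zj = nonedge _ (old j∈ j≢u) zj
        adj⇐⁺ (no i≢u)   (yes refl) i∈ _  iz = Graph.symm H (nonedge _ (old i∈ i≢u) (Graph.symm G iz))
        adj⇐⁺ (no i≢u)   (no j≢u)   i∈ j∈ ij = adj⇐ _ _ (old i∈ i≢u) (old j∈ j≢u) ij
        far⁺ : ∀ {i j} (i? : Dec (i ≡ u)) (j? : Dec (j ≡ u)) → i ∈ D⁺ → j ∈ D⁺ → i ≢ j →
               ∀ x → x ∈ update i? I (M′ i) → ¬ x ∈ N[_] G (update₀ j? z (f j))
        far⁺ (yes refl) (yes refl) _  _  i≢j x x∈ = contradiction refl i≢j
        far⁺ (yes refl) (no j≢u)   _  j∈ i≢j x x∈ = proj₁ (R-avoids (I⊆R x x∈) _ (old j∈ j≢u))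
        far⁺ (no i≢u)   (yes refl) i∈ _  i≢j x x∈ = proj₂ x∈
        far⁺ (no i≢u)   (no j≢u)   i∈ j∈ i≢j x x∈ = far _ _ (old i∈ i≢u) (old j∈ j≢u) i≢j x (proj₁ x∈)
        sparse-new : ∀ j → j ∈ D → w * links I (M′ j) ≤ card (M′ j) * card I
        sparse-new j j∈D = begin
          w * links I (M′ j)                          ≡⟨ *-∑ I w _ ⟩
          ∑ I (λ y → w * card (N[_] G y ∩ M′ j))      ≤⟨ ∑-bound I _ (card (M′ j)) few ⟩
          card (M′ j) * card I                        ∎
          where
          few : ∀ y → y ∈ I → w * card (N[_] G y ∩ M′ j) ≤ card (M′ j)
          few y y∈I = *-cancelˡ-≤ 4 (begin
            4 * (w * card (N[_] G y ∩ M′ j))   ≡⟨ *-assoc 4 w _ ⟨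
            4 * w * card (N[_] G y ∩ M′ j)     ≤⟨ *-monoʳ-≤ (4 * w) (card-mono (N[_] G y ∩ M′ j) (N[_] G y ∩ M j)
                                                    λ { x (yx , x∈M , _) → yx , x∈M }) ⟩
            4 * w * card (N[_] G y ∩ M j)      ≤⟨ <⇒≤ (proj₂ (R-avoids (I⊆R y y∈I) j j∈D)) ⟩
            card (M j)                         ≤⟨ M≤2M′ j j∈D ⟩
            2 * card (M′ j)                    ≤⟨ *-monoˡ-≤ (card (M′ j)) (s≤s (s≤s (z≤n {2}))) ⟩
            4 * card (M′ j)                    ∎)
        -- Inside `I` the only links are from a vertex to itself. Mixed pairs are sparse because `I`
        -- avoids the crowds, and in old pairs the two halvings cost the factor 4.
        sparse⁺ : ∀ {i j} (i? : Dec (i ≡ u)) (j? : Dec (j ≡ u)) → i ∈ D⁺ → j ∈ D⁺ →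
                  w * links (update i? I (M′ i)) (update j? I (M′ j)) ≤
                  card (update i? I (M′ i)) * card (update j? I (M′ j))
        sparse⁺ (yes _) (yes _) _ _ = begin
          w * links I I          ≤⟨ *-monoʳ-≤ w (∑-bound I _ 1 λ y y∈I → ≤-trans
                                      (card-mono (N[_] G y ∩ I) ⁅ y ⁆ λ where
                                        x (inj₁ y≡x , _)   → y≡x
                                        x (inj₂ yx  , x∈I) → contradiction yx (I-stable y x y∈I x∈I))
                                      (card-⁅⁆ y)) ⟩
          w * (1 * card I)       ≡⟨ cong (w *_) (*-identityˡ (card I)) ⟩
          w * card I             ≤⟨ *-monoˡ-≤ (card I) w≤I ⟩
          card I * card I        ∎
        sparse⁺ {j = j} (yes _) (no j≢u) _ j∈ =
          ≤-trans (sparse-new j (old j∈ j≢u)) (≤-reflexive (*-comm (card (M′ j)) (card I)))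
        sparse⁺ {i} (no i≢u) (yes _) i∈ _ =
          ≤-trans (≤-reflexive (cong (w *_) (links-sym (M′ i) I))) (sparse-new i (old i∈ i≢u))
        sparse⁺ {i} {j} (no i≢u) (no j≢u) i∈ j∈ = *-cancelˡ-≤ 4 (begin
          4 * (w * links (M′ i) (M′ j))       ≡⟨ *-assoc 4 w _ ⟨
          4 * w * links (M′ i) (M′ j)         ≤⟨ *-monoʳ-≤ (4 * w) (links-mono (M′ i) (M i) (M′ j) (M j)
                                                   (λ _ → proj₁) (λ _ → proj₁)) ⟩
          4 * w * links (M i) (M j)           ≤⟨ sparse i j (old i∈ i≢u) (old j∈ j≢u) ⟩
          card (M i) * card (M j)             ≤⟨ *-mono-≤ (M≤2M′ i (old i∈ i≢u)) (M≤2M′ j (old j∈ j≢u)) ⟩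
          2 * card (M′ i) * (2 * card (M′ j)) ≡⟨ regroup (card (M′ i)) (card (M′ j)) ⟩
          4 * (card (M′ i) * card (M′ j))     ∎)
          where
          regroup : ∀ a b → 2 * a * (2 * b) ≡ 4 * (a * b)
          regroup = solve-∀

    -- Induction on `t`: a leaf is deleted from `D`, the rest is embedded with four times the
    -- weight, and the leaf is placed last.
    build : (∀ D v → v ∈ D → ∃[ u ] (u ∈ D × Leaf H D u)) → Vertex G →
            ∀ t w D → t ≤ h → card D ≤ t → 4 ^ t * w ≤ W → 4 * suc h ≤ w → State D t w
    build leaf x₀ t w D t≤h D≤t w≤W h≤w with Fin.any? (member? D)
    -- Over an empty `D` all conditions are vacuous, and `x₀` is a default value.
    ... | no ∄i = record
      { f      = λ _ → x₀
      ; M      = λ _ → ∅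
      ; f∈X    = λ i i∈ → ⊥-elim (∄i (i , i∈))
      ; M⊆N    = λ _ _ _ ()
      ; M⊆U    = λ _ _ _ ()
      ; large  = λ i i∈ → ⊥-elim (∄i (i , i∈))
      ; inj    = λ i _ i∈ → ⊥-elim (∄i (i , i∈))
      ; adj⇒   = λ i _ i∈ → ⊥-elim (∄i (i , i∈))
      ; adj⇐   = λ i _ i∈ → ⊥-elim (∄i (i , i∈))
      ; far    = λ _ _ _ _ _ _ ()
      ; sparse = λ i _ i∈ → ⊥-elim (∄i (i , i∈))
      }
    build leaf x₀ zero w D t≤h D≤t w≤W h≤w | yes (v , v∈D) =
      contradiction (≤-trans (card-positive D v∈D) D≤t) λ ()
    build leaf x₀ (suc t) w D t<h D≤t w≤W h≤w | yes (v , v∈D) with leaf D v v∈D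
    ... | u , u∈D , u-leaf = Step.place {w = w} t<h state 4w≤W h≤4w {u = u} (λ x → proj₂ x refl)
      (λ i i∈ i≢u → i∈ , i≢u ∘ sym) (candidate u-leaf)
      where
      D⁻ : FinSet h
      D⁻ = D ∖ ⁅ u ⁆
      shrink : suc (card D⁻) ≤ card D
      shrink = ≤-trans (+-monoˡ-≤ _ (card-positive ⁅ u ⁆ {u} refl))
        (∑-disjoint ⁅ u ⁆ D⁻ D _ (λ { _ refl → u∈D }) (λ _ → proj₁) λ { _ refl (_ , u≢u) → u≢u refl })
      4w≤W′ : 4 ^ t * (4 * w) ≤ W
      4w≤W′ = ≤-trans (≤-reflexive (trans (sym (*-assoc (4 ^ t) 4 w)) (cong (_* w) (*-comm (4 ^ t) 4)))) w≤W
      4w≤W : 4 * w ≤ W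
      4w≤W = ≤-trans (m≤n*m (4 * w) (4 ^ t) ⦃ m^n≢0 4 t ⦄) 4w≤W′
      h≤4w : 4 * suc h ≤ 4 * w
      h≤4w = ≤-trans h≤w (m≤n*m w 4)
      state : State D⁻ t (4 * w)
      state = build leaf x₀ t (4 * w) D⁻ (<⇒≤ t<h) (≤-pred (≤-trans shrink D≤t)) 4w≤W′ h≤4w
      open Step {D = D⁻} {w = w} t<h state 4w≤W h≤4w using (Candidate; isolatedCandidate; childCandidate)
      candidate : Leaf H D u → Candidate (Adj H u)
      candidate (inj₁ isolated) = isolatedCandidate λ i i∈ → isolated i (proj₁ i∈)
      candidate (inj₂ (p , p∈D , up , unique)) = childCandidate p
        (p∈D , λ u≡p → Graph.irrefl H u≡p up) up λ i i∈ → unique i (proj₁ i∈)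

    embedding : (∀ D v → v ∈ D → ∃[ u ] (u ∈ D × Leaf H D u)) → Vertex G → InducedCopy H G
    embedding leaf x₀ = record
      { embed     = f
      ; injective = λ {i} {j} → inj i j tt tt
      ; adjacency = λ i j → mk⇔ (adj⇒ i j tt tt) (adj⇐ i j tt tt)
      }
      where
      open State (build leaf x₀ h (4 * suc h) full ≤-refl (≤-reflexive (card-full h)) ≤-refl ≤-refl)

-- Leaves of forests

-- Values beyond index `m` are arbitrary members of `D`, which spares dependent indexing. The path
-- grows at `p 0`.
record Path (H : Graph) (D : FinSet (order H)) (m : ℕ) : Set where
  field
    p   : ℕ → Vertex H
    p∈D : ∀ i → p i ∈ D
    inj : ∀ i j → i ≤ m → j ≤ m → p i ≡ p j → i ≡ j
    adj : ∀ i → i ℕ.< m → Adj H (p i) (p (suc i))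

module _ (H : Graph) (forest : IsForest H) (D : FinSet (order H)) where

  open Graph H using (adj?; symm; irrefl)

  path-length : ∀ {m} → Path H D m → suc m ≤ order H
  path-length path = Fin.injective⇒≤ {f = λ i → p (toℕ i)} λ {i} {j} eq →
    Fin.toℕ-injective (inj _ _ (Fin.toℕ≤pred[n] i) (Fin.toℕ≤pred[n] j) eq)
    where open Path path

  path-extend : ∀ {m} (path : Path H D m) y → y ∈ D → Adj H y (Path.p path 0) →
                (∀ j → j ≤ m → Path.p path j ≢ y) → Path H D (suc m)
  path-extend {m} path y y∈D y0 new = record { p = p⁺ ; p∈D = p⁺∈D ; inj = inj⁺ ; adj = adj⁺ }
    where
    open Path path
    p⁺ : ℕ → Vertex H
    p⁺ zero    = y
    p⁺ (suc i) = p i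
    p⁺∈D : ∀ i → p⁺ i ∈ D
    p⁺∈D zero    = y∈D
    p⁺∈D (suc i) = p∈D i
    inj⁺ : ∀ i j → i ≤ suc m → j ≤ suc m → p⁺ i ≡ p⁺ j → i ≡ j
    inj⁺ zero    zero    _       _       _  = refl
    inj⁺ zero    (suc j) _       (s≤s j≤) eq = contradiction (sym eq) (new j j≤)
    inj⁺ (suc i) zero    (s≤s i≤) _       eq = contradiction eq (new i i≤)
    inj⁺ (suc i) (suc j) (s≤s i≤) (s≤s j≤) eq = cong suc (inj i j i≤ j≤ eq)
    adj⁺ : ∀ i → i ℕ.< suc m → Adj H (p⁺ i) (p⁺ (suc i))
    adj⁺ zero    _        = y0
    adj⁺ (suc i) (s≤s i<) = adj i i<

  path-cycle : ∀ {m} (path : Path H D m) → let open Path path in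
               ∀ l → 2 + l ≤ m → Adj H (p 0) (p (2 + l)) → Cycle H
  path-cycle path l le chord = record
    { l        = l
    ; vertex   = λ i → p (toℕ i)
    ; distinct = λ {i} {j} eq → Fin.toℕ-injective (inj _ _ (bound i) (bound j) eq)
    ; step     = λ i → subst (λ a → Adj H (p a) (p (suc (toℕ i)))) (sym (Fin.toℕ-inject₁ i))
                         (adj (toℕ i) (≤-trans (Fin.toℕ<n i) le))
    ; close    = subst (λ a → Adj H (p a) (p 0)) (sym (Fin.toℕ-fromℕ (2 + l))) (symm chord)
    }
    where
    open Path path
    bound : ∀ (i : Fin (3 + l)) → toℕ i ≤ _
    bound i = ≤-trans (Fin.toℕ≤pred[n] i) le

  -- A path that cannot be prolonged starts at a leaf. Paths have at most `order H` vertices, so `b`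
  -- bounds the number of prolongations still possible.
  path-leaf : ∀ b {m} → Path H D m → order H ≤ m + b → ∃[ u ] (u ∈ D × Leaf H D u)
  path-leaf zero {m} path le =
    contradiction (≤-trans (path-length path) (≤-trans le (≤-reflexive (+-identityʳ m)))) (n≮n m)
  path-leaf (suc b) {zero} path le
    with Fin.any? (λ y → member? D y ×-dec adj? (Path.p path 0) y)
  ... | no ∄y = Path.p path 0 , Path.p∈D path 0 , inj₁ λ i i∈D xi → ∄y (i , i∈D , xi)
  ... | yes (y , y∈D , xy) = path-leaf b
    (path-extend path y y∈D (symm xy) λ { zero z≤n p≡y → irrefl p≡y xy }) le
  path-leaf (suc b) {suc m} path le
    with Fin.any? (λ y → member? D y ×-dec (adj? (Path.p path 0) y ×-dec ¬? (y Fin.≟ Path.p path 1)))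
  ... | no ∄y = p 0 , p∈D 0 , inj₂ (p 1 , p∈D 1 , adj 0 (s≤s z≤n) , λ i i∈D xi →
    decidable-stable (i Fin.≟ p 1) λ i≢ → ∄y (i , i∈D , xi , i≢))
    where open Path path
  ... | yes (y , y∈D , xy , y≢p1) with Fin.any? {n = 2 + m} (λ j → Path.p path (toℕ j) Fin.≟ y)
  ...   | no ∄j = path-leaf b
    (path-extend path y y∈D (symm xy) λ j j≤ eq → ∄j (fromℕ< (s≤s j≤) ,
      trans (cong (Path.p path) (Fin.toℕ-fromℕ< (s≤s j≤))) eq))
    (≤-trans le (≤-reflexive (+-suc (suc m) b)))
  -- The second neighbour `y` lies on the path: index 0 would be a loop, index 1 is excluded by
  -- choice, and a later index closes a cycle.
  ...   | yes (zero         , eq) = contradiction xy (irrefl eq)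
  ...   | yes (suc zero     , eq) = contradiction (sym eq) y≢p1
  ...   | yes (suc (suc j)  , eq) = contradiction
    (path-cycle path (toℕ j) (s≤s (Fin.toℕ<n j)) (subst (Adj H (Path.p path 0)) (sym eq) xy)) forest

  forest-leaf : ∀ v → v ∈ D → ∃[ u ] (u ∈ D × Leaf H D u)
  forest-leaf v v∈D = path-leaf (order H) {0} (record
    { p   = λ _ → v
    ; p∈D = λ _ → v∈D
    ; inj = λ { zero zero _ _ _ → refl }
    ; adj = λ _ ()
    }) ≤-refl

-- Stable sets of nearly linear size

toSubset : FinSet n → Subset n
toSubset P = tabulate λ x → does (member? P x)

fromSubset : Subset n → FinSet n
fromSubset S = ⟅ (_∈ˢ? S) ⟆

∈-toSubset⁻ : (P : FinSet n) → ∀ x → x ∈ˢ toSubset P → x ∈ P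
∈-toSubset⁻ P x x∈S = go (member? P x) (trans (sym (lookup∘tabulate _ x)) ([]=⇒lookup x∈S))
  where
  go : (a? : Dec (x ∈ P)) → does a? ≡ true → x ∈ P
  go (yes a) _ = a

∈-toSubset⁺ : (P : FinSet n) → ∀ x → x ∈ P → x ∈ˢ toSubset P
∈-toSubset⁺ P x x∈P =
  lookup⇒[]= x (toSubset P) (trans (lookup∘tabulate _ x) (dec-true (member? P x) x∈P))

∣toSubset∣ : (P : FinSet n) → ∣ toSubset P ∣ ≡ card P
∣toSubset∣ {zero}  P = refl
∣toSubset∣ {suc n} P with member? P zero
... | yes _ = cong suc (∣toSubset∣ (tail P))
... | no _  = ∣toSubset∣ (tail P)

-- That is, α(G[X]) ≥ |X| / (C d)^(1/q).
HasLargeStable : (G : Graph) → FinSet (order G) → (q C d : ℕ) → Set₁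
HasLargeStable G X q C d = ∃[ I ] (I ⊆ X × IsStable G I × card X ^ q ≤ C * card I ^ q * d)

-- Passing to `Subset` makes the search for a stable set finite; this decision is what allows
-- arguing from a counterexample.
hasLargeStable? : ∀ G X q C d → Dec (HasLargeStable G X q C d)
hasLargeStable? G X q C d = map′
  (λ (S , S⊆X , st , le) → fromSubset S , S⊆X , st , le)
  (λ (I , I⊆X , st , le) → toSubset I
    , (λ x x∈ → I⊆X x (∈-toSubset⁻ I x x∈))
    , (λ x y x∈ y∈ → st x y (∈-toSubset⁻ I x x∈) (∈-toSubset⁻ I y y∈))
    , ≤-trans le (*-monoˡ-≤ d (*-monoʳ-≤ C (^-monoˡ-≤ q
        (card-mono I (fromSubset (toSubset I)) (∈-toSubset⁺ I))))))
  (anySubset? λ S →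
    Fin.all? (λ x → (x ∈ˢ? S) →-dec member? X x) ×-dec
    (stable? G S ×-dec (card X ^ q ≤? C * card (fromSubset S) ^ q * d)))

^-cancelʳ-≤ : ∀ {a b} q .⦃ _ : NonZero q ⦄ → a ^ q ≤ b ^ q → a ≤ b
^-cancelʳ-≤ {a} {b} q le with a ≤? b
... | yes a≤b = a≤b
... | no a≰b  = contradiction le (<⇒≱ (^-monoˡ-< q (≰⇒> a≰b)))

root : ∀ Q .⦃ _ : NonZero Q ⦄ d → ∃[ b ] (b ^ Q ≤ d × d ℕ.< suc b ^ Q)
root Q@(suc _) zero = 0 , z≤n , m^n>0 1 Q
root Q (suc d) with root Q d
... | b , ≤d , d< with suc b ^ Q ≤? suc d
...   | yes le = suc b , le , ≤-<-trans d< (^-monoˡ-< Q (n<1+n (suc b)))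
...   | no  ≰  = b , ≤-trans ≤d (n≤1+n d) , ≰⇒> ≰

-- Induction on clique number and degree

module _ (H : Graph) (forest : IsForest H) where

  private
    h : ℕ
    h = order H

  -- `C` precedes `G`, `X` and `d`, so the bound is uniform. Speaking of subsets `X` lets the
  -- induction enter neighbourhoods while `G` stays fixed.
  NearLinear : ℕ → Set₁
  NearLinear k = ∀ q → .⦃ NonZero q ⦄ → ∃[ C ] (1 ≤ C × (∀ G → G IsFreeOf H → ∀ X d →
    CliqueFree G k X → 1 ≤ d → MaxDegree≤ G X d → HasLargeStable G X q C d))

  module Induct (k : ℕ) (nearLinear : NearLinear k) (q : ℕ) .⦃ _ : NonZero q ⦄ where

    E Q K β d₀ C : ℕ
    -- The first summand is the power of `B` demanded by `Critical`; `3 * q` serves the lower bound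
    -- on `card X`.
    E = suc (exponent q h) + 3 * q
    -- Doubling makes room for constants: with `b` the integer `Q`-th root of `d` and `2 * C₁ ≤ b`,
    -- one gets `(2 * C₁ * b) ^ E ≤ b ^ Q ≤ d`.
    Q = E + E

    C₁ : ℕ
    C₁ = proj₁ (nearLinear Q)

    -- The sum of the constants that `B` must dominate in `Critical` and `Embed`.
    K = 16 * suc h + (4 ^ q + 2 * suc h * suc (4 ^ h * (4 * suc h)))
    β = 2 * C₁ + K
    -- From `d₀` on, the integer `Q`-th root of `d` is at least `β`.
    d₀ = β ^ Q
    -- Large enough for the greedy bound to settle all degrees up to `d₀`.
    C = suc d₀ ^ q

    1≤C : 1 ≤ C
    1≤C = m^n>0 (suc d₀) q

    module Fixed (G : Graph) (free : G IsFreeOf H) where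

      small : ∀ X d → d ≤ d₀ → 1 ≤ d → MaxDegree≤ G X d → HasLargeStable G X q C d
      small X d d≤d₀ 1≤d deg with greedyStable G X deg
      ... | I , I⊆X , st , le = I , I⊆X , st , (begin
        card X ^ q                 ≤⟨ ^-monoˡ-≤ q le ⟩
        (suc d * card I) ^ q       ≡⟨ ^-distribʳ-* (suc d) (card I) q ⟩
        suc d ^ q * card I ^ q     ≤⟨ *-monoˡ-≤ (card I ^ q) (^-monoˡ-≤ q (s≤s d≤d₀)) ⟩
        C * card I ^ q             ≤⟨ m≤m*n (C * card I ^ q) d ⦃ ℕ.>-nonZero 1≤d ⦄ ⟩
        C * card I ^ q * d         ∎)
        where open ≤-Reasoning

      -- A counterexample `X` of large degree `d`, all smaller degrees being settled by `ih`. It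
      -- meets the hypotheses of `Critical`, so `H` embeds, a contradiction.
      module Large (X : FinSet (order G)) (d b : ℕ) (d₀≤d : d₀ ≤ d)
        (b^Q≤d : b ^ Q ≤ d) (d<b^Q : d ℕ.< suc b ^ Q)
        (cf : CliqueFree G (suc k) X) (deg : MaxDegree≤ G X d)
        (ih : ∀ Y d′ → Y ⊆ X → 1 ≤ d′ → d′ ℕ.< d → MaxDegree≤ G Y d′ → HasLargeStable G Y q C d′)
        (none : ∀ I → I ⊆ X → IsStable G I → C * card I ^ q * d ℕ.< card X ^ q)
        where

        open ≤-Reasoning

        B : ℕ
        B = 2 * C₁ * b

        1≤C₁ : 1 ≤ C₁
        1≤C₁ = proj₁ (proj₂ (nearLinear Q))

        β≤b : β ≤ b
        β≤b with β ≤? b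
        ... | yes le = le
        ... | no ≰   = contradiction (≤-trans d<b^Q (≤-trans (^-monoˡ-≤ Q (≰⇒> ≰)) d₀≤d)) (n≮n d)

        b≤B : b ≤ B
        b≤B = m≤n*m b (2 * C₁) ⦃ ℕ.>-nonZero (≤-trans 1≤C₁ (m≤n*m C₁ 2)) ⦄

        K≤B : K ≤ B
        K≤B = ≤-trans (≤-trans (m≤n+m K (2 * C₁)) β≤b) b≤B

        16[1+h]≤B : 16 * suc h ≤ B
        16[1+h]≤B = ≤-trans (m≤m+n _ _) K≤B

        16≤B : 16 ≤ B
        16≤B = ≤-trans (*-monoʳ-≤ 16 (s≤s {0} {h} z≤n)) 16[1+h]≤B

        instance
          B≢0 : NonZero B
          B≢0 = ℕ.>-nonZero (≤-trans (s≤s z≤n) 16≤B)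

        B^E≤d : B ^ E ≤ d
        B^E≤d = begin
          B ^ E                   ≡⟨ ^-distribʳ-* (2 * C₁) b E ⟩
          (2 * C₁) ^ E * b ^ E    ≤⟨ *-monoˡ-≤ (b ^ E) (^-monoˡ-≤ E (≤-trans (m≤m+n (2 * C₁) K) β≤b)) ⟩
          b ^ E * b ^ E           ≡⟨ ^-distribˡ-+-* b E E ⟨
          b ^ Q                   ≤⟨ b^Q≤d ⟩
          d                       ∎

        B≤d : B ≤ d
        B≤d = ≤-trans (≤-trans (≤-reflexive (sym (^-identityʳ B))) (^-monoʳ-≤ B {1} {E} (s≤s z≤n))) B^E≤d

        1≤d : 1 ≤ d
        1≤d = ≤-trans (s≤s z≤n) (≤-trans 16≤B B≤d)

        -- Neighbourhoods have smaller clique number, so the inductive bound with exponent `1 / Q`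
        -- applies. Its loss `C₁ * d ^ (1 / Q)` is at most `C₁ * (2 * b)`, which is `B`.
        local : ∀ v S → v ∈ X → S ⊆ N G v ∩ X →
                ∃[ I ] (I ⊆ S × IsStable G I × card S ≤ B * card I)
        local v S v∈X S⊆ with proj₂ (proj₂ (nearLinear Q)) G free S d
          (cliqueFree-⊆ G k (N G v ∩ X) S S⊆ (cf v v∈X)) 1≤d
          (maxDegree-⊆ G X S (λ x x∈S → proj₂ (S⊆ x x∈S)) deg)
        ... | I , I⊆S , st , le = I , I⊆S , st , ^-cancelʳ-≤ Q (begin
          card S ^ Q                             ≤⟨ le ⟩
          C₁ * card I ^ Q * d                    ≤⟨ *-mono-≤ (*-monoˡ-≤ (card I ^ Q) C₁≤) d≤ ⟩
          C₁ ^ Q * card I ^ Q * (2 * b) ^ Q      ≡⟨ cong (_* (2 * b) ^ Q) (^-distribʳ-* C₁ (card I) Q) ⟨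
          (C₁ * card I) ^ Q * (2 * b) ^ Q        ≡⟨ ^-distribʳ-* (C₁ * card I) (2 * b) Q ⟨
          (C₁ * card I * (2 * b)) ^ Q            ≡⟨ cong (_^ Q) (regroup C₁ (card I) b) ⟩
          (B * card I) ^ Q                       ∎)
          where
          C₁≤ : C₁ ≤ C₁ ^ Q
          C₁≤ = ≤-trans (≤-reflexive (sym (^-identityʳ C₁)))
            (^-monoʳ-≤ C₁ ⦃ ℕ.>-nonZero 1≤C₁ ⦄ {1} {Q} (s≤s z≤n))
          d≤ : d ≤ (2 * b) ^ Q
          d≤ = ≤-trans (<⇒≤ d<b^Q) (^-monoˡ-≤ Q (+-mono-≤ 1≤b (≤-reflexive (sym (+-identityʳ b)))))
            where
            1≤b : 1 ≤ b
            1≤b = ≤-trans (≤-trans 1≤C₁ (≤-trans (m≤n*m C₁ 2) (m≤m+n (2 * C₁) K))) β≤b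
          regroup : ∀ c i b → c * i * (2 * b) ≡ 2 * c * b * i
          regroup = solve-∀

        -- A stable set found in `Y` is also one in `X`, where it must be too small; comparing the
        -- two bounds cancels `C` and `card I`.
        critical : ∀ Y d′ → Y ⊆ X → 1 ≤ d′ → d′ ℕ.< d → MaxDegree≤ G Y d′ →
                   card Y ^ q * d ℕ.< card X ^ q * d′
        critical Y d′ Y⊆X 1≤d′ d′<d deg′ with ih Y d′ Y⊆X 1≤d′ d′<d deg′
        ... | I , I⊆Y , st , le = begin-strict
          card Y ^ q * d              ≤⟨ *-monoˡ-≤ d le ⟩
          C * card I ^ q * d′ * d     ≡⟨ regroup (C * card I ^ q) d′ d ⟩
          C * card I ^ q * d * d′     <⟨ *-monoˡ-< d′ ⦃ ℕ.>-nonZero 1≤d′ ⦄ (none I (λ x x∈ → Y⊆X x (I⊆Y x x∈)) st) ⟩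
          card X ^ q * d′             ∎
          where
          regroup : ∀ a b c → a * b * c ≡ a * c * b
          regroup = solve-∀

        1≤n : 1 ≤ card X
        1≤n with card X | none ∅ (λ _ ()) (λ _ _ ())
        ... | zero  | lt = contradiction (≤-trans lt (≤-reflexive (0^ q))) λ ()
          where
          0^ : ∀ q .⦃ _ : NonZero q ⦄ → 0 ^ q ≡ 0
          0^ (suc q) = refl
        ... | suc _ | _  = s≤s z≤n

        -- Otherwise `X` has maximum degree at most `d - 1`, and criticality applied to `X` itself
        -- is absurd.
        topVertex : ∃[ v ] (v ∈ X × d ≤ card (N G v ∩ X))
        topVertex with Fin.any? (λ v → member? X v ×-dec (d ≤? card (N G v ∩ X)))
        ... | yes v = v
        ... | no ∄v = contradiction
          (critical X (ℕ.pred d) (λ _ x∈ → x∈) 1≤d-1 d-1<d λ v v∈X →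
            ≤-pred (≤-trans (≰⇒> λ le → ∄v (v , v∈X , le)) (≤-reflexive (sym 1+[d-1]))))
          (≤⇒≯ (*-monoʳ-≤ (card X ^ q) (<⇒≤ d-1<d)))
          where
          1+[d-1] : suc (ℕ.pred d) ≡ d
          1+[d-1] = suc-pred d ⦃ ℕ.>-nonZero 1≤d ⦄
          d-1<d : ℕ.pred d ℕ.< d
          d-1<d = ≤-reflexive 1+[d-1]
          1≤d-1 : 1 ≤ ℕ.pred d
          1≤d-1 = ≤-pred (≤-trans (s≤s (s≤s z≤n)) (≤-trans (≤-trans 16≤B B≤d) (≤-reflexive (sym 1+[d-1]))))

        -- The neighbourhood of a vertex of degree `d` contains a stable set of size at least
        -- `d / B`. In a smaller `X` this set would already be large enough.
        4Bd≤n : 4 * (B * d) ≤ card X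
        4Bd≤n with 4 * (B * d) ≤? card X
        ... | yes le = le
        ... | no ≰   = contradiction (none I (λ x x∈ → proj₂ (I⊆ x x∈)) st) (≤⇒≯ (begin
          card X ^ q                   ≤⟨ ^-monoˡ-≤ q n≤ ⟩
          (B ^ 3 * card I) ^ q         ≡⟨ ^-distribʳ-* (B ^ 3) (card I) q ⟩
          (B ^ 3) ^ q * card I ^ q     ≡⟨ cong (_* card I ^ q) (^-*-assoc B 3 q) ⟩
          B ^ (3 * q) * card I ^ q     ≤⟨ *-monoˡ-≤ (card I ^ q) (≤-trans (^-monoʳ-≤ B (m≤n+m (3 * q) (suc (exponent q h)))) B^E≤d) ⟩
          d * card I ^ q               ≡⟨ *-comm d (card I ^ q) ⟩
          card I ^ q * d               ≤⟨ *-monoˡ-≤ d (m≤n*m (card I ^ q) C ⦃ ℕ.>-nonZero 1≤C ⦄) ⟩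
          C * card I ^ q * d           ∎))
          where
          v = proj₁ topVertex
          S = N G v ∩ X
          stable = local v S (proj₁ (proj₂ topVertex)) (λ _ x∈ → x∈)
          I = proj₁ stable
          I⊆ = proj₁ (proj₂ stable)
          st = proj₁ (proj₂ (proj₂ stable))
          n≤ : card X ≤ B ^ 3 * card I
          n≤ = begin
            card X                        ≤⟨ <⇒≤ (≰⇒> ≰) ⟩
            4 * (B * d)                   ≤⟨ *-mono-≤ (≤-trans (s≤s (s≤s (s≤s (s≤s (z≤n {12}))))) 16≤B) (*-monoʳ-≤ B
                                               (≤-trans (proj₂ (proj₂ topVertex)) (proj₂ (proj₂ (proj₂ stable))))) ⟩
            B * (B * (B * card I))        ≡⟨ regroup B (card I) ⟩
            B ^ 3 * card I                ∎
            where
            regroup : ∀ b i → b * (b * (b * i)) ≡ b * (b * (b * 1)) * i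
            regroup = solve-∀

        open Critical G H X q d B deg critical local 16[1+h]≤B
          (≤-trans (^-monoʳ-≤ B (m≤m+n (suc (exponent q h)) (3 * q))) B^E≤d) 1≤n

        absurd : ⊥
        absurd = unobstructed λ (U , U⊆X , X≤2U , clear) → free (Embed.embedding U U⊆X X≤2U clear
          (≤-trans (≤-trans (m≤m+n (4 ^ q) _) (m≤n+m _ (16 * suc h))) K≤B)
          (≤-trans (≤-trans (m≤n+m _ (4 ^ q)) (m≤n+m _ (16 * suc h))) K≤B)
          4Bd≤n (forest-leaf H forest) (proj₁ (nonempty X 1≤n)))

      -- Strong induction on `d`, with `b` as its bound.
      go : ∀ b X d → d ≤ b → CliqueFree G (suc k) X → 1 ≤ d → MaxDegree≤ G X d →
           HasLargeStable G X q C d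
      go b X d d≤b cf 1≤d deg with d ≤? d₀
      ... | yes d≤d₀ = small X d d≤d₀ 1≤d deg
      go zero X d d≤b cf 1≤d deg | no _ = contradiction (≤-trans 1≤d d≤b) λ ()
      go (suc b) X d d≤b cf 1≤d deg | no d≰d₀ with hasLargeStable? G X q C d
      ... | yes found = found
      ... | no ∄I     = ⊥-elim (Large.absurd X d (proj₁ r) (<⇒≤ (≰⇒> d≰d₀))
        (proj₁ (proj₂ r)) (proj₂ (proj₂ r)) cf deg
        (λ Y d′ Y⊆X 1≤d′ d′<d deg′ → go b Y d′ (≤-pred (≤-trans d′<d d≤b))
          (cliqueFree-⊆ G (suc k) X Y Y⊆X cf) 1≤d′ deg′)
        λ I I⊆X st → ≰⇒> λ le → ∄I (I , I⊆X , st , le))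
        where r = root Q d

  nearLinear : ∀ k → NearLinear k
  nearLinear zero q = 1 , ≤-refl , λ G free X d cf 1≤d deg → X , (λ _ x∈ → x∈)
    , (λ x _ x∈X → contradiction x∈X (cf x))
    , ≤-trans (≤-reflexive (sym (*-identityˡ (card X ^ q))))
              (m≤m*n (1 * card X ^ q) d ⦃ ℕ.>-nonZero 1≤d ⦄)
  nearLinear (suc k) q = I.C , I.1≤C , λ G free X d cf 1≤d deg →
    I.Fixed.go G free d X d ≤-refl cf 1≤d deg
    where module I = Induct k (nearLinear k) q

-- Cliques, colourings and real powers

module _ (G : Graph) where

  open Graph G using (symm; irrefl)

  Clique : ℕ → FinSet (order G) → Set
  Clique m X = Σ (Fin m → Vertex G) λ f →
    (∀ i → f i ∈ X) × (∀ i j → i ≢ j → Adj G (f i) (f j))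

  noClique⇒cliqueFree : ∀ k X → ¬ Clique (suc k) X → CliqueFree G k X
  noClique⇒cliqueFree zero X none v v∈X =
    none ((λ _ → v) , (λ _ → v∈X) , λ { zero zero i≢j → contradiction refl i≢j })
  noClique⇒cliqueFree (suc k) X none v v∈X =
    noClique⇒cliqueFree k (N G v ∩ X) λ (f , f∈ , adj) → none
      ( (λ { zero → v ; (suc i) → f i })
      , (λ { zero → v∈X ; (suc i) → proj₂ (f∈ i) })
      , λ { zero    zero    i≢j → contradiction refl i≢j
          ; zero    (suc j) _   → proj₁ (f∈ j)
          ; (suc i) zero    _   → symm (proj₁ (f∈ i))
          ; (suc i) (suc j) i≢j → adj i j (i≢j ∘ cong suc) })

  free⇒cliqueFree : ∀ k → G IsFreeOf complete (suc k) → CliqueFree G k full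
  free⇒cliqueFree k free = noClique⇒cliqueFree k full λ (f , _ , adj) → free record
    { embed     = f
    ; injective = λ {i} {j} eq → decidable-stable (i Fin.≟ j) λ i≢j → irrefl eq (adj i j i≢j)
    ; adjacency = λ i j → mk⇔ (adj i j) λ { fij refl → irrefl refl fij }
    }

  maxDegree-card : ∀ X → MaxDegree≤ G X (card X)
  maxDegree-card X v _ = card-mono (N G v ∩ X) X λ _ → proj₂

  maxDegree-order : MaxDegree≤ G full (order G)
  maxDegree-order v _ = card≤n (N G v ∩ full)

  card≤α : ∀ I → IsStable G I → card I ≤ α G
  card≤α I st = proj₂ (proj₂ (maxStableSet G)) (card I) (toSubset I
    , (λ u v u∈ v∈ → st u v (∈-toSubset⁻ I u u∈) (∈-toSubset⁻ I v v∈))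
    , ∣toSubset∣ I)

  -- Colours are natural numbers, so the palette can grow without relabelling.
  ColourableOn : FinSet (order G) → ℕ → Set
  ColourableOn X m = Σ (Vertex G → ℕ) λ c → (∀ x → x ∈ X → c x ℕ.< m) ×
    (∀ x y → x ∈ X → y ∈ X → Adj G x y → c x ≢ c y)

  χ≤ : ∀ m → ColourableOn full m → χ G ≤ m
  χ≤ m (c , c<m , proper) = proj₂ (proj₂ (minColouring G)) m
    ( (λ v → fromℕ< (c<m v tt))
    , λ u v uv eq → proper u v tt tt uv (Fin.fromℕ<-injective (c u) (c v) (c<m u tt) (c<m v tt) eq))

  colourableOn-≤ : ∀ X {m n} → m ≤ n → ColourableOn X m → ColourableOn X n
  colourableOn-≤ X m≤n (c , c<m , proper) = c , (λ x x∈ → ≤-trans (c<m x x∈) m≤n) , proper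

  colourableOn-∖ : ∀ X I m → IsStable G I → ColourableOn (X ∖ I) m → ColourableOn X (suc m)
  colourableOn-∖ X I m st (c , c<m , proper) =
    (λ x → c⁺ x (member? I x)) , (λ x → bound x (member? I x)) ,
    λ x y x∈ y∈ xy → proper⁺ x y (member? I x) (member? I y) x∈ y∈ xy
    where
    c⁺ : ∀ x → Dec (x ∈ I) → ℕ
    c⁺ x (yes _) = m
    c⁺ x (no _)  = c x
    bound : ∀ x (i? : Dec (x ∈ I)) → x ∈ X → c⁺ x i? ℕ.< suc m
    bound x (yes _)  x∈ = ≤-refl
    bound x (no x∉I) x∈ = ≤-trans (c<m x (x∈ , x∉I)) (n≤1+n m)
    proper⁺ : ∀ x y (x? : Dec (x ∈ I)) (y? : Dec (y ∈ I)) → x ∈ X → y ∈ X → Adj G x y →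
              c⁺ x x? ≢ c⁺ y y?
    proper⁺ x y (yes x∈I) (yes y∈I) x∈ y∈ xy _  = st x y x∈I y∈I xy
    proper⁺ x y (yes _)   (no y∉I)  x∈ y∈ xy eq = <⇒≢ (c<m y (y∈ , y∉I)) (sym eq)
    proper⁺ x y (no x∉I)  (yes _)   x∈ y∈ xy eq = <⇒≢ (c<m x (x∈ , x∉I)) eq
    proper⁺ x y (no x∉I)  (no y∉I)  x∈ y∈ xy eq = proper x y (x∈ , x∉I) (y∈ , y∉I) xy eq

-- Sets of size below (2^q)^i need O(2^i) colours: the colours used to go from
-- one power of 2^q down to the previous one form a geometric series.
module Colouring (G : Graph) (q C : ℕ) .⦃ _ : NonZero q ⦄ (1≤C : 1 ≤ C)
  (nearLinear : ∀ X → 1 ≤ card X → HasLargeStable G X q C (card X)) where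

  open ≤-Reasoning

  D : ℕ
  D = 2 ^ q

  D^ : ∀ i → D ^ i ≡ (2 ^ i) ^ q
  D^ i = trans (^-*-assoc 2 q i) (trans (cong (2 ^_) (*-comm q i)) (sym (^-*-assoc 2 i q)))

  1≤D^ : ∀ i → 1 ≤ D ^ i
  1≤D^ i = m^n>0 D ⦃ m^n≢0 2 q ⦄ i

  colours : ℕ → ℕ
  colours i = 2 * C * D * 2 ^ i

  rate : ℕ → ℕ
  rate i = C * 2 ^ suc i

  -- The size of `X` serves as its degree bound, and `card X ≤ (2 ^ suc i) ^ q` allows taking `q`-th
  -- roots.
  stableFraction : ∀ i X → 1 ≤ card X → card X ≤ D ^ suc i →
                   ∃[ I ] (I ⊆ X × IsStable G I × card X ≤ rate i * card I)
  stableFraction i X 1≤X X≤ with nearLinear X 1≤X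
  ... | I , I⊆X , st , le = I , I⊆X , st , ^-cancelʳ-≤ q (begin
    card X ^ q                              ≤⟨ le ⟩
    C * card I ^ q * card X                 ≤⟨ *-mono-≤ (*-monoˡ-≤ (card I ^ q) C≤C^q) (≤-trans X≤ (≤-reflexive (D^ (suc i)))) ⟩
    C ^ q * card I ^ q * (2 ^ suc i) ^ q    ≡⟨ cong (_* (2 ^ suc i) ^ q) (^-distribʳ-* C (card I) q) ⟨
    (C * card I) ^ q * (2 ^ suc i) ^ q      ≡⟨ ^-distribʳ-* (C * card I) (2 ^ suc i) q ⟨
    (C * card I * 2 ^ suc i) ^ q            ≡⟨ cong (_^ q) (regroup C (card I) (2 ^ suc i)) ⟩
    (rate i * card I) ^ q                   ∎)
    where
    C≤C^q : C ≤ C ^ q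
    C≤C^q = ≤-trans (≤-reflexive (sym (^-identityʳ C)))
      (^-monoʳ-≤ C ⦃ ℕ.>-nonZero 1≤C ⦄ {1} {q} (ℕ.>-nonZero⁻¹ q))
    regroup : ∀ a b c → a * b * c ≡ a * c * b
    regroup = solve-∀

  module Stage (i m : ℕ) (smaller : ∀ X → card X ℕ.< D ^ i → ColourableOn G X m) where

    -- `s` is a budget of colours. Each colour class removed lowers `rate i * card X` by at least
    -- the current size of `X`, hence by at least `D ^ i`.
    stage : ∀ s X → card X ≤ D ^ suc i → rate i * card X ≤ s * D ^ i → ColourableOn G X (s + m)
    stage s X X≤ le with card X <? D ^ i
    ... | yes X< = colourableOn-≤ G X (m≤n+m m s) (smaller X X<)
    stage zero X X≤ le | no X≮ = contradiction
      (≤-trans (m≤n*m (card X) (rate i) ⦃ m*n≢0 C (2 ^ suc i) ⦃ ℕ.>-nonZero 1≤C ⦄ ⦃ m^n≢0 2 (suc i) ⦄ ⦄) le)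
      (<⇒≱ (≤-trans (1≤D^ i) (≮⇒≥ X≮)))
    stage (suc s) X X≤ le | no X≮ with stableFraction i X (≤-trans (1≤D^ i) (≮⇒≥ X≮)) X≤
    ... | I , I⊆X , st , X≤I = colourableOn-∖ G X I (s + m) st
      (stage s (X ∖ I) (≤-trans (card-mono (X ∖ I) X λ _ → proj₁) X≤)
        (+-cancelˡ-≤ (D ^ i) _ _ (begin
          D ^ i + rate i * card (X ∖ I)               ≤⟨ +-monoˡ-≤ _ (≤-trans (≮⇒≥ X≮) X≤I) ⟩
          rate i * card I + rate i * card (X ∖ I)     ≡⟨ *-distribˡ-+ (rate i) (card I) _ ⟨
          rate i * (card I + card (X ∖ I))            ≤⟨ *-monoʳ-≤ (rate i) (∑-disjoint I (X ∖ I) X _ I⊆X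
                                                           (λ _ → proj₁) λ x x∈I x∈ → proj₂ x∈ x∈I) ⟩
          rate i * card X                             ≤⟨ le ⟩
          D ^ i + s * D ^ i                           ∎)))

  colouring : ∀ i X → card X ℕ.< D ^ i → ColourableOn G X (colours i)
  colouring zero X X<1 = (λ _ → 0)
    , (λ x x∈ → contradiction X<1 (≤⇒≯ (card-positive X x∈)))
    , λ x y x∈ → contradiction X<1 (≤⇒≯ (card-positive X x∈))
  colouring (suc i) X X< = colourableOn-≤ G X (≤-reflexive (regroup C D (2 ^ i)))
    (Stage.stage i (colours i) (colouring i) (rate i * D) X (<⇒≤ X<)
      (≤-trans (*-monoʳ-≤ (rate i) (<⇒≤ X<)) (≤-reflexive (sym (*-assoc (rate i) D (D ^ i))))))
    where
    regroup : ∀ c d x → c * (2 * x) * d + 2 * c * d * x ≡ 2 * c * d * (2 * x)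
    regroup = solve-∀

  -- For `D ^ i ≤ order G`, less than the next power, the colouring uses `4 * C * D * 2 ^ i`
  -- colours, and the `q`-th power of `2 ^ i` is `D ^ i`.
  χ-bound : 1 ≤ order G → χ G ^ q ≤ (4 * C * D) ^ q * order G
  χ-bound 1≤n = bound (scale (order G) 1≤n)
    where
    1<D : 1 ℕ.< D
    1<D = ^-monoʳ-≤ 2 (ℕ.>-nonZero⁻¹ q)
    scale : ∀ n → 1 ≤ n → ∃[ i ] (D ^ i ≤ n × n ℕ.< D ^ suc i)
    scale (suc zero) _ = 0 , ≤-refl , ≤-trans 1<D (≤-reflexive (sym (*-identityʳ D)))
    scale (suc (suc n)) _ with scale (suc n) (s≤s z≤n)
    ... | i , ≤n , n< with D ^ suc i ≤? suc (suc n)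
    ...   | no ≰   = i , ≤-trans ≤n (n≤1+n (suc n)) , ≰⇒> ≰
    ...   | yes le = suc i , le , ≤-<-trans n< (^-monoʳ-< D 1<D (n<1+n (suc i)))
    bound : ∃[ i ] (D ^ i ≤ order G × order G ℕ.< D ^ suc i) → χ G ^ q ≤ (4 * C * D) ^ q * order G
    bound (i , ≤n , n<) = begin
      χ G ^ q                              ≤⟨ ^-monoˡ-≤ q (χ≤ G (colours (suc i)) (colouring (suc i) full
                                                (≤-trans (≤-reflexive (cong suc (card-full (order G)))) n<))) ⟩
      colours (suc i) ^ q                  ≡⟨ cong (_^ q) (regroup C D (2 ^ i)) ⟩
      (4 * C * D * 2 ^ i) ^ q              ≡⟨ ^-distribʳ-* (4 * C * D) (2 ^ i) q ⟩
      (4 * C * D) ^ q * (2 ^ i) ^ q        ≡⟨ cong ((4 * C * D) ^ q *_) (D^ i) ⟨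
      (4 * C * D) ^ q * D ^ i              ≤⟨ *-monoʳ-≤ ((4 * C * D) ^ q) ≤n ⟩
      (4 * C * D) ^ q * order G            ∎
      where
      regroup : ∀ c d x → 2 * c * d * (2 * x) ≡ 4 * c * d * x
      regroup = solve-∀

-- Rational exponents

posPart-⊖ : ∀ m n → posPart (m ⊖ n) + n ≡ m + negPart (m ⊖ n)
posPart-⊖ m n with n ≤? m
... | yes n≤m rewrite ℤ.⊖-≥ n≤m = trans (m∸n+n≡m n≤m) (trans (sym (+-identityʳ m)) (cong (m +_) (sym (negPart-pos (m ∸ n)))))
  where
  negPart-pos : ∀ a → negPart (pos a) ≡ 0
  negPart-pos zero    = refl
  negPart-pos (suc a) = refl
... | no n≰m rewrite ℤ.⊖-< (≰⇒> n≰m) = parts (n ∸ m) (m+[n∸m]≡n (<⇒≤ (≰⇒> n≰m)))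
  where
  parts : ∀ a → m + a ≡ n → posPart (neg (pos a)) + n ≡ m + negPart (neg (pos a))
  parts zero    eq = sym eq
  parts (suc a) eq = sym eq

-- Weakens the exponent `1 - 1 / b` to `1 - a / b`. Here `P` and `M` are the positive and negative
-- parts of `b - a`, and multiplying by `n ^ a` treats both signs at once.
power-exchange : ∀ n x b a {P M} → 1 ≤ n → 1 ≤ a → P + a ≡ b + M → n ^ b ≤ x ^ b * n →
                 n ^ P ≤ x ^ b * n ^ M
power-exchange n x b a {P} {M} 1≤n 1≤a eq le = *-cancelʳ-≤ _ _ (n ^ a) ⦃ m^n≢0 n a ⦄ (begin
  n ^ P * n ^ a           ≡⟨ ^-distribˡ-+-* n P a ⟨
  n ^ (P + a)             ≡⟨ cong (n ^_) eq ⟩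
  n ^ (b + M)             ≡⟨ ^-distribˡ-+-* n b M ⟩
  n ^ b * n ^ M           ≤⟨ *-monoˡ-≤ (n ^ M) le ⟩
  x ^ b * n * n ^ M       ≤⟨ *-monoˡ-≤ (n ^ M) (*-monoʳ-≤ (x ^ b) n≤n^a) ⟩
  x ^ b * n ^ a * n ^ M   ≡⟨ regroup (x ^ b) (n ^ a) (n ^ M) ⟩
  x ^ b * n ^ M * n ^ a   ∎)
  where
  open ≤-Reasoning
  instance
    n≢0 : NonZero n
    n≢0 = ℕ.>-nonZero 1≤n
  n≤n^a : n ≤ n ^ a
  n≤n^a = ≤-trans (≤-reflexive (sym (^-identityʳ n))) (^-monoʳ-≤ n 1≤a)
  regroup : ∀ a b c → a * b * c ≡ a * c * b
  regroup = solve-∀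

-- Working with exponent `1 / (2 * b)` leaves a spare factor `n` under the square root, which
-- absorbs `C`.
stable-power : ∀ n i C b .⦃ _ : NonZero b ⦄ → C ≤ n → n ^ (b * 2) ≤ C * i ^ (b * 2) * n →
               n ^ b ≤ i ^ b * n
stable-power n i C b C≤n le = ^-cancelʳ-≤ 2 (begin
  (n ^ b) ^ 2                ≡⟨ ^-*-assoc n b 2 ⟩
  n ^ (b * 2)                ≤⟨ le ⟩
  C * i ^ (b * 2) * n        ≤⟨ *-monoˡ-≤ n (*-monoˡ-≤ (i ^ (b * 2)) C≤n) ⟩
  n * i ^ (b * 2) * n        ≡⟨ cong (λ z → n * z * n) (^-*-assoc i b 2) ⟨
  n * (i ^ b) ^ 2 * n        ≡⟨ regroup n (i ^ b) ⟩
  (i ^ b * n) ^ 2            ∎)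
  where
  open ≤-Reasoning
  regroup : ∀ n x → n * (x * (x * 1)) * n ≡ x * n * (x * n * 1)
  regroup = solve-∀

mainTheorem1 : (H : Graph) → IsForest H → (k : ℕ) → 1 ≤ k →
    ((ε : ℚᵘ) → 0ℚᵘ < ε →
    ∃[ n₀ ] ((G : Graph) → G IsFreeOf H → G IsFreeOf (complete (suc k)) →
    n₀ ≤ order G → Power≤ (order G) (1ℚᵘ - ε) (α G)))
    ×
    ((ε : ℚᵘ) → 0ℚᵘ < ε →
    ∃[ C ] ((G : Graph) → G IsFreeOf H → G IsFreeOf (complete (suc k)) →
    1 ≤ order G → ≤Power (χ G) C (order G) ε))
mainTheorem1 H forest k _ = stableSet , colour
  where
  stableSet : (ε : ℚᵘ) → 0ℚᵘ < ε →
    ∃[ n₀ ] ((G : Graph) → G IsFreeOf H → G IsFreeOf (complete (suc k)) →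
    n₀ ≤ order G → Power≤ (order G) (1ℚᵘ - ε) (α G))
  stableSet (mkℚᵘ (pos zero) b-1) (*<* (+<+ ()))
  stableSet (mkℚᵘ -[1+ _ ] b-1) (*<* ())
  -- For `ε` with denominator `b` the exponent is `1 / (2 * b)`, and `n₀` is `C`, so that the
  -- constant is at most the order.
  stableSet ε@(mkℚᵘ (pos (suc a-1)) b-1) _ with nearLinear H forest k (1 * suc b-1 * 2)
  ... | C , 1≤C , near = C , bound
    where
    bound : (G : Graph) → G IsFreeOf H → G IsFreeOf (complete (suc k)) →
            C ≤ order G → Power≤ (order G) (1ℚᵘ - ε) (α G)
    bound G freeH freeK C≤n with near G freeH full (order G) (free⇒cliqueFree G k freeK)
                                   (≤-trans 1≤C C≤n) (maxDegree-order G)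
    ... | I , _ , st , le =
      power-exchange (order G) (α G) b a (≤-trans 1≤C C≤n) (s≤s z≤n) (posPart-⊖ b a) n^b≤
      where
      -- The numerator and denominator of 1ℚᵘ - ε, as they compute.
      b = 1 * suc b-1
      a = suc a-1 * 1
      n^b≤ : order G ^ b ≤ α G ^ b * order G
      n^b≤ = ≤-trans
        (stable-power (order G) (card I) C b C≤n
          (subst (λ z → z ^ (b * 2) ≤ C * card I ^ (b * 2) * order G) (card-full (order G)) le))
        (*-monoˡ-≤ (order G) (^-monoˡ-≤ b (card≤α G I st)))

  colour : (ε : ℚᵘ) → 0ℚᵘ < ε →
    ∃[ C ] ((G : Graph) → G IsFreeOf H → G IsFreeOf (complete (suc k)) →
    1 ≤ order G → ≤Power (χ G) C (order G) ε)
  colour (mkℚᵘ (pos zero) b-1) (*<* (+<+ ()))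
  colour (mkℚᵘ -[1+ _ ] b-1) (*<* ())
  -- The exponent `1 / b` suffices, since the order is at most its own power with exponent the
  -- numerator of `ε`.
  colour (mkℚᵘ (pos (suc a-1)) b-1) _ with nearLinear H forest k (suc b-1)
  ... | C , 1≤C , near = 4 * C * 2 ^ suc b-1 , λ G freeH freeK 1≤n →
    let open Colouring G (suc b-1) C 1≤C (λ X 1≤X → near G freeH X (card X)
               (cliqueFree-⊆ G k full X (λ _ _ → tt) (free⇒cliqueFree G k freeK)) 1≤X (maxDegree-card G X))
    in ≤-trans (≤-trans (≤-reflexive (*-identityʳ (χ G ^ suc b-1))) (χ-bound 1≤n))
         (*-monoʳ-≤ ((4 * C * 2 ^ suc b-1) ^ suc b-1)
           (m≤m*n (order G) (order G ^ a-1) ⦃ m^n≢0 (order G) a-1 ⦃ ℕ.>-nonZero 1≤n ⦄ ⦄))
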